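{- Let $\{X_t\}$ be an irreducible Markov chain on a countable state space $\Sigma$ for which there exist a function $V:\Sigma\to\mathbb R_+$ and constants $\nu_{\max},\gamma>0$ and $b\ge0$ such that: (1) the set $B=\{x\in\Sigma:V(x)\le b\}$ is finite; (2) for all $x,y\in\Sigma$ with $\mathbb P(X_{t+1}=y\mid X_t=x)>0$, $|V(y)-V(x)|\le\nu_{\max}$; (3) for all $x\in\Sigma$ with $V(x)>b$, $\mathbb E[V(X_{t+1})-V(X_t)\mid X_t=x]<-\gamma$. Then for any $i\in B$ and for all $k\in\mathbb Z_+$, $$\mathbb P_i(T_i>k)\le4\cdot2^{ -k/R_i},$$ where $$R_i=O\left(\frac{H_i^B\,e^{2\eta\nu_{\max}}}{(1-\rho)(e^{\eta\nu_{\max}}-\rho)}\right).$$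
   Context: $\mathbb P_i(\cdot)=\mathbb P(\cdot\mid X_0=i)$, $\mathbb E_i[\cdot]=\mathbb E[\cdot\mid X_0=i]$; $T_i=\inf\{t\ge1:X_t=i\}$; $\mathbb Z_+$ denotes the positive integers. Restricted chain: with $S_0=0$ and $S_k=\min\{t>S_{k-1}:X_t\in B\}$, let $Y_t=X_{S_t}$, a Markov chain on $B$ with transition probabilities $P_Y(x,y)=\mathbb P(X_{S_1}=y\mid X_0=x)$ for $x,y\in B$. Let $T_i^B=\inf\{t\ge1:Y_t=i\}$ and $H_i^B=\max_{j\in B}\mathbb E_j[T_i^B]$. The scalars are $\eta=\frac{\gamma}{2(e-2)\nu_{\max}^2}$ and $\rho=1-\frac{\gamma^2}{4(e-2)\nu_{\max}^2}$. The claim asserts existence of a constant $R_i$ of the stated order for which the tail bound holds. -}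

module Defs where

open import Algebra.Bundles using (CommutativeRing; Semiring)
import Algebra.Construct.NaturalChoice.Max as Max
import Algebra.Definitions.RawSemiring as RawSemiringDefs
open import Data.List.Base using (List; foldr; map)
open import Data.List.Relation.Unary.All using (All)
open import Data.List.Membership.Propositional using (_∈_)
open import Data.List.Relation.Unary.Unique.Propositional using (Unique)
open import Data.Nat.Base using (ℕ; suc; _!)
open import Data.Product.Base using (∃; _×_)
open import Data.Refinement.Base using (Refinement-syntax; value)
open import Data.Unit.Base using (⊤)
open import Data.Vec.Base using (Vec; []; _∷_; init; last)
import Data.Vec.Relation.Unary.All as VecAll
open import Level using (0ℓ) renaming (suc to lsuc)
open import Relation.Binary.Bundles using (DecTotalOrder)
open import Relation.Binary.Core using (Rel)
open import Relation.Binary.Structures using (IsDecTotalOrder)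
import Relation.Binary.Construct.NonStrictToStrict as Strict
open import Relation.Binary.PropositionalEquality using (_≡_; _≢_)
open import Relation.Nullary using (¬_; yes; no)
open import Relation.Unary using (Pred; U; ∁)

-- The real numbers, as a (classically unique) complete ordered field.
-- Inverse and supremum are total operations that are constrained only
-- at non-zero elements, resp. at inhabited bounded subsets.
record CompleteOrderedField : Set (lsuc 0ℓ) where
  infix  8 _⁻¹
  infixl 7 _/_
  infix  4 _≤_
  field
    commutativeRing : CommutativeRing 0ℓ 0ℓ

  open CommutativeRing commutativeRing public renaming (Carrier to ℝ)

  field
    _≤_             : Rel ℝ 0ℓ
    isDecTotalOrder : IsDecTotalOrder _≈_ _≤_
    +-monoʳ-≤       : ∀ x {y z} → y ≤ z → x + y ≤ x + z
    *-nonNegative   : ∀ {x y} → 0# ≤ x → 0# ≤ y → 0# ≤ x * y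
    0≉1             : ¬ (0# ≈ 1#)
    _⁻¹             : ℝ → ℝ
    ⁻¹-inverseʳ     : ∀ {x} → ¬ (x ≈ 0#) → x * x ⁻¹ ≈ 1#

  IsUpperBound : Pred ℝ 0ℓ → ℝ → Set
  IsUpperBound S u = ∀ x → S x → x ≤ u

  IsLub : Pred ℝ 0ℓ → ℝ → Set
  IsLub S s = IsUpperBound S s × (∀ u → IsUpperBound S u → s ≤ u)

  field
    ⨆       : Pred ℝ 0ℓ → ℝ
    ⨆-isLub : ∀ S → ∃ S → ∃ (IsUpperBound S) → IsLub S (⨆ S)

  decTotalOrder : DecTotalOrder 0ℓ 0ℓ 0ℓ
  decTotalOrder = record { isDecTotalOrder = isDecTotalOrder }

  open DecTotalOrder decTotalOrder public using (totalOrder; _≤?_)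
  open Strict _≈_ _≤_ public using (_<_)
  open Max totalOrder public using (_⊔_)
  open RawSemiringDefs (Semiring.rawSemiring semiring) public
    using (_^_) renaming (_×_ to _·_)

  _/_ : ℝ → ℝ → ℝ
  x / y = x * y ⁻¹

  fromℕ : ℕ → ℝ
  fromℕ n = n · 1#

  ∣_∣ : ℝ → ℝ
  ∣ x ∣ = x ⊔ - x

module Analysis (𝓡 : CompleteOrderedField) where
  open CompleteOrderedField 𝓡

  FiniteSum : {I : Set} → Pred I 0ℓ → (I → ℝ) → Pred ℝ 0ℓ
  FiniteSum S f r =
    ∃ λ xs → Unique xs × All S xs × r ≈ foldr _+_ 0# (map f xs)

  -- Unordered sums; ∑ and HasSum are meaningful for non-negative f only,
  -- and ∑ only when the finite partial sums are bounded.
  ∑ : {I : Set} → Pred I 0ℓ → (I → ℝ) → ℝ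
  ∑ S f = ⨆ (FiniteSum S f)

  HasSum : {I : Set} → Pred I 0ℓ → (I → ℝ) → ℝ → Set
  HasSum S f = IsLub (FiniteSum S f)

  -- Mean of a signed f under the probability mass function q.
  𝔼 : {I : Set} → (I → ℝ) → (I → ℝ) → ℝ
  𝔼 q f = ∑ U (λ y → q y * (f y ⊔ 0#)) - ∑ U (λ y → q y * (- f y ⊔ 0#))

  expSeries : ℝ → ℝ
  expSeries x = ∑ U (λ n → x ^ n / fromℕ (n !))

  exp : ℝ → ℝ
  exp x with 0# ≤? x
  ... | yes _ = expSeries x
  ... | no  _ = expSeries (- x) ⁻¹

  e : ℝ
  e = exp 1#

  log : ℝ → ℝ
  log a = ⨆ (λ y → exp y ≤ a)

  infixr 8 _**_
  _**_ : ℝ → ℝ → ℝ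
  a ** x = exp (x * log a)

module Chains (𝓡 : CompleteOrderedField) where
  open CompleteOrderedField 𝓡
  open Analysis 𝓡

  Kernel : Set → Set
  Kernel A = A → A → ℝ

  record IsStochastic {A : Set} (p : Kernel A) : Set where
    field
      nonNegative : ∀ x y → 0# ≤ p x y
      rowSum      : ∀ x → HasSum U (p x) 1#

  pathWeight : {A : Set} → Kernel A → A → ∀ {n} → Vec A n → ℝ
  pathWeight p x []       = 1#
  pathWeight p x (y ∷ ys) = p x y * pathWeight p y ys

  -- ℙ p x n E is the probability, for the chain started at x, that the
  -- trajectory (X₁ , … , Xₙ) lies in E.
  ℙ : {A : Set} → Kernel A → A → ∀ n → Pred (Vec A n) 0ℓ → ℝ
  ℙ p x n E = ∑ E (pathWeight p x)

  IsIrreducible : {A : Set} → Kernel A → Set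
  IsIrreducible p = ∀ x y → ∃ λ n → 0# < ℙ p x n (λ xs → last (x ∷ xs) ≡ y)

  -- For trajectories from time 1: the first t ≥ 1 with X_t ∈ S is n + 1.
  FirstVisit : {A : Set} → Pred A 0ℓ → ∀ {n} → Pred (Vec A (suc n)) 0ℓ
  FirstVisit S xs = VecAll.All (∁ S) (init xs) × S (last xs)

  ℙ[Return>_] : ℕ → {A : Set} → Kernel A → A → A → ℝ
  ℙ[Return> k ] p j i = ℙ p j k (VecAll.All (_≢ i))

  ℙ[Return≡1+_] : ℕ → {A : Set} → Kernel A → A → A → ℝ
  ℙ[Return≡1+ n ] p j i = ℙ p j (suc n) (FirstVisit (_≡ i))

  𝔼[Return] : {A : Set} → Kernel A → A → A → ℝ
  𝔼[Return] p j i = ∑ U (λ n → fromℕ (suc n) * ℙ[Return≡1+ n ] p j i)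

  -- The expected return time is finite: the return time is almost surely
  -- finite and the series for its mean converges.
  FiniteMeanReturn : {A : Set} → Kernel A → A → A → Set
  FiniteMeanReturn p j i =
    HasSum U (λ n → ℙ[Return≡1+ n ] p j i) 1# ×
    HasSum U (λ n → fromℕ (suc n) * ℙ[Return≡1+ n ] p j i) (𝔼[Return] p j i)

  module Restriction {A : Set} (p : Kernel A) (V : A → ℝ) (b : ℝ) where

    B : Set
    B = [ x ∈ A ∣ V x ≤ b ]

    Finite-B : Set
    Finite-B = ∃ λ (xs : List B) → ∀ x → x ∈ xs

    -- P_Y(x,y) = P_x(X_{S₁} = y), summed over the possible values n + 1
    -- of the first time S₁ ≥ 1 at which the chain is in B.
    pʸ : Kernel B
    pʸ x y = ∑ U λ n → ℙ p (value x) (suc n) λ xs →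
      FirstVisit (λ z → V z ≤ b) xs × last xs ≡ value y

    -- B is finite, so this supremum is a maximum.
    H : B → ℝ
    H i = ⨆ (λ r → ∃ λ j → r ≈ 𝔼[Return] pʸ j i)

  module Scalars (γ ν : ℝ) where
    two four : ℝ
    two  = fromℕ 2
    four = fromℕ 4

    η ρ : ℝ
    η = γ / (two * (e - two) * ν ^ 2)
    ρ = 1# - γ ^ 2 / (four * (e - two) * ν ^ 2)

    rate : ℝ → ℝ
    rate h = h * exp (two * η * ν) / ((1# - ρ) * (exp (η * ν) - ρ))

{-# OPTIONS --safe #-}

-- For x ∈ B let h(x) = E_x[T_i^B] ≤ H, and for x ∉ B let h(x) be the mean of h
-- over the point where B is entered, counting 0 for i. Let w = exp(s (V − b))
-- off B and w = 0 on B, with s = γ / 4ν². Off the target, h decreases in mean by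
-- one on B and does not grow off B, while the drift makes w contract in mean by
-- the factor 1 − δ off B, δ = γ² / 8ν², and its mean after a step from B is at
-- most 2. Hence f = 1 + h/H + w/4H satisfies E_x[f(X₁); X₁ ≠ i] ≤ (1 − 1/R) f(x)
-- with R = 4H (1 + 4/δ); since f ≥ 1 and f(i) ≤ 2,
-- P_i(T_i > k) ≤ 2 (1 − 1/R)^k ≤ 2 exp(−k/R).
--
-- Finiteness of the means comes from irreducibility: some N and ε > 0 satisfy
-- P_j(T_i^B > N) ≤ 1 − ε for all j ∈ B. Only the double negation of this is
-- available constructively, which suffices because ≤ is decidable.
--
-- About exp only (1 + y − x) exp x ≤ exp y ≤ exp x + (y − x) exp y for
-- 0 ≤ x ≤ y is used, never the addition formula.

module Submission where

open import Defs
open import Algebra.Bundles using (CommutativeRing)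
import Algebra.Properties.Ring as RingProperties
import Algebra.Properties.Semiring.Mult as Mult
import Algebra.Properties.Semiring.Mult.TCOptimised as Multiples
import Algebra.Solver.Ring as RingSolver
open import Algebra.Solver.Ring.AlmostCommutativeRing
  using (fromCommutativeRing; _-Raw-AlmostCommutative⟶_)
open import Data.Empty using (⊥-elim)
open import Data.Integer.Base as ℤ using (ℤ; -[1+_])
import Data.Integer.Properties as ℤ
open import Data.Irrelevant using ([_])
open import Data.List.Base using (List; []; _∷_; _++_; map; filter; foldr; deduplicate; downFrom)
open import Data.List.Membership.Propositional.Properties
  using (∈-∃++; ∈-++⁻; ∈-++⁺ˡ; ∈-++⁺ʳ; ∈-deduplicate⁺; ∈-downFrom⁺)
open import Data.List.Relation.Binary.Subset.Propositional using (_⊆_)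
open import Data.List.Relation.Unary.All as All using (All; []; _∷_)
import Data.List.Relation.Unary.All.Properties as All
open import Data.List.Relation.Unary.AllPairs using ([]; _∷_)
open import Data.List.Relation.Unary.Any using (here; there)
open import Data.List.Relation.Unary.Unique.DecPropositional.Properties using (deduplicate-!)
open import Data.List.Relation.Unary.Unique.Propositional using (Unique)
import Data.List.Relation.Unary.Unique.Propositional.Properties as Unique
open import Data.Maybe.Base using (Maybe; just; nothing)
open import Data.Nat.Base as ℕ using (ℕ; zero; suc; _!; NonZero)
import Data.Nat.Properties as ℕ
open import Data.Product.Base using (∃; _×_; _,_; proj₁; proj₂)
open import Data.Refinement.Base using (value; _,_)
open import Data.Refinement.Properties as Refinement using (value-injective)
import Data.Sign.Base as Sign
open import Data.Sum.Base using (_⊎_; inj₁; inj₂; [_,_]′)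
open import Data.Vec.Base using (Vec; []; _∷_; head; init; last)
import Data.Vec.Properties as Vec
import Data.Vec.Relation.Unary.All as VecAll
open import Function.Base using (_∘_; id)
open import Function.Bundles using (_↣_)
open import Level using (0ℓ)
open import Relation.Binary.Definitions using (DecidableEquality)
open import Relation.Binary.PropositionalEquality as ≡ using (_≡_; _≢_)
open import Relation.Binary.Structures using (IsDecTotalOrder)
open import Relation.Nullary using (¬_; Dec; yes; no)
open import Relation.Nullary.Decidable using (¬?; decidable-stable; recompute; via-injection)
open import Relation.Unary using (Pred; U; ∁; _∩_; Decidable)

-- Neither `h` nor `w` decreases everywhere: `h` stands still off `B`, and `w` may rise from 0 to 2
-- in mean on a step from `B`. The weights in f balance the two. On `B`, h/H earns 1/H and w/4H
-- costs at most 1/2H; the remaining 1/2H pays for f/R, because f is at most 2 there. Off `B`, w/4H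
-- earns at least δw/4H, which pays for f/R, because f is at most 2 + w/4H, hence at most 3w. Both
-- accounts close when 1/R is at most 1/4H and 3/R is at most δ/4H, and this R satisfies both. The
-- summand 1 keeps f above the survival probability at time 0 where `h` and `w` are small. The
-- scalars η and ρ of the statement enter only when R is compared with the claimed order. With κ = e
-- - 2, u = ην and μ = γ/4ν one has κu = 2μ and 1 - ρ = κu², so everything becomes a polynomial
-- inequality between u and exponentials of u and 2u. A second obstacle is that `H` is a supremum,
-- meaningful only once the mean return times are known to be bounded; that has to be derived before
-- any of this can be used.

-- A ring solver with integer coefficients.

module IntegerCoefficients (R : CommutativeRing 0ℓ 0ℓ) where
  open CommutativeRing R
  open RingProperties ring using (-0#≈0#; -‿+-comm; -‿involutive; -‿distribˡ-*; -‿distribʳ-*)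
  open Multiples semiring using (1+×; ×-homo-+; ×1-homo-*) renaming (_×_ to _×′_)
  open import Relation.Binary.Reasoning.Setoid setoid

  -- The optimised multiple makes the coefficients 0 and 1 denote `0#` and `1#` definitionally, with
  -- no trailing `+ 0#`.
  ⟦_⟧ : ℤ → Carrier
  ⟦ ℤ.+ n    ⟧ = n ×′ 1#
  ⟦ -[1+ n ] ⟧ = - (suc n ×′ 1#)

  ⟦-⟧ : ∀ i → ⟦ ℤ.- i ⟧ ≈ - ⟦ i ⟧
  ⟦-⟧ (ℤ.+ zero)   = sym -0#≈0#
  ⟦-⟧ (ℤ.+ suc n)  = refl
  ⟦-⟧ -[1+ n ]   = sym (-‿involutive _)

  cancel-suc : ∀ a b → (1# + a) - (1# + b) ≈ a - b
  cancel-suc a b = begin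
    (1# + a) - (1# + b)     ≈⟨ +-cong (+-comm 1# a) (sym (-‿+-comm 1# b)) ⟩
    (a + 1#) + (- 1# - b)   ≈⟨ +-assoc a 1# _ ⟩
    a + (1# + (- 1# - b))   ≈⟨ +-congˡ (sym (+-assoc 1# (- 1#) (- b))) ⟩
    a + ((1# - 1#) - b)     ≈⟨ +-congˡ (+-congʳ (-‿inverseʳ 1#)) ⟩
    a + (0# - b)            ≈⟨ +-congˡ (+-identityˡ _) ⟩
    a - b                   ∎

  ⟦⊖⟧ : ∀ m n → ⟦ m ℤ.⊖ n ⟧ ≈ m ×′ 1# - n ×′ 1#
  ⟦⊖⟧ m       zero    = trans (sym (+-identityʳ _)) (+-congˡ (sym -0#≈0#))
  ⟦⊖⟧ zero    (suc n) = sym (+-identityˡ _)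
  ⟦⊖⟧ (suc m) (suc n) = begin
    ⟦ suc m ℤ.⊖ suc n ⟧                ≡⟨ ≡.cong ⟦_⟧ (ℤ.[1+m]⊖[1+n]≡m⊖n m n) ⟩
    ⟦ m ℤ.⊖ n ⟧                        ≈⟨ ⟦⊖⟧ m n ⟩
    m ×′ 1# - n ×′ 1#                  ≈⟨ sym (cancel-suc _ _) ⟩
    (1# + m ×′ 1#) - (1# + n ×′ 1#)    ≈⟨ +-cong (sym (1+× m 1#)) (-‿cong (sym (1+× n 1#))) ⟩
    suc m ×′ 1# - suc n ×′ 1#          ∎

  ⟦+⟧ : ∀ i j → ⟦ i ℤ.+ j ⟧ ≈ ⟦ i ⟧ + ⟦ j ⟧
  ⟦+⟧ (ℤ.+ m)    (ℤ.+ n)    = ×-homo-+ 1# m n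
  ⟦+⟧ (ℤ.+ m)    -[1+ n ] = ⟦⊖⟧ m (suc n)
  ⟦+⟧ -[1+ m ] (ℤ.+ n)    = trans (⟦⊖⟧ n (suc m)) (+-comm _ _)
  ⟦+⟧ -[1+ m ] -[1+ n ] = begin
    - (suc (suc (m ℕ.+ n)) ×′ 1#)          ≡⟨ ≡.cong (λ k → - (suc k ×′ 1#)) (≡.sym (ℕ.+-suc m n)) ⟩
    - ((suc m ℕ.+ suc n) ×′ 1#)            ≈⟨ -‿cong (×-homo-+ 1# (suc m) (suc n)) ⟩
    - (suc m ×′ 1# + suc n ×′ 1#)          ≈⟨ sym (-‿+-comm _ _) ⟩
    - (suc m ×′ 1#) - (suc n ×′ 1#)        ∎

  ⟦◃⟧⁺ : ∀ n → ⟦ Sign.+ ℤ.◃ n ⟧ ≈ n ×′ 1#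
  ⟦◃⟧⁺ zero    = refl
  ⟦◃⟧⁺ (suc n) = refl

  ⟦◃⟧⁻ : ∀ n → ⟦ Sign.- ℤ.◃ n ⟧ ≈ - (n ×′ 1#)
  ⟦◃⟧⁻ zero    = sym -0#≈0#
  ⟦◃⟧⁻ (suc n) = refl

  ⟦*⟧ : ∀ i j → ⟦ i ℤ.* j ⟧ ≈ ⟦ i ⟧ * ⟦ j ⟧
  ⟦*⟧ (ℤ.+ m)    (ℤ.+ n)    = trans (⟦◃⟧⁺ (m ℕ.* n)) (×1-homo-* m n)
  ⟦*⟧ (ℤ.+ m)    -[1+ n ] = begin
    _                               ≈⟨ ⟦◃⟧⁻ (m ℕ.* suc n) ⟩
    - ((m ℕ.* suc n) ×′ 1#)         ≈⟨ -‿cong (×1-homo-* m (suc n)) ⟩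
    - ((m ×′ 1#) * (suc n ×′ 1#))   ≈⟨ -‿distribʳ-* _ _ ⟩
    (m ×′ 1#) * - (suc n ×′ 1#)     ∎
  ⟦*⟧ -[1+ m ] (ℤ.+ n)    = begin
    _                               ≈⟨ ⟦◃⟧⁻ (suc m ℕ.* n) ⟩
    - ((suc m ℕ.* n) ×′ 1#)         ≈⟨ -‿cong (×1-homo-* (suc m) n) ⟩
    - ((suc m ×′ 1#) * (n ×′ 1#))   ≈⟨ -‿distribˡ-* _ _ ⟩
    - (suc m ×′ 1#) * (n ×′ 1#)     ∎
  ⟦*⟧ -[1+ m ] -[1+ n ] = begin
    _                                   ≈⟨ ⟦◃⟧⁺ (suc m ℕ.* suc n) ⟩
    (suc m ℕ.* suc n) ×′ 1#             ≈⟨ ×1-homo-* (suc m) (suc n) ⟩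
    (suc m ×′ 1#) * (suc n ×′ 1#)       ≈⟨ sym (-‿involutive _) ⟩
    - - ((suc m ×′ 1#) * (suc n ×′ 1#)) ≈⟨ -‿cong (-‿distribˡ-* _ _) ⟩
    - (- (suc m ×′ 1#) * (suc n ×′ 1#)) ≈⟨ -‿distribʳ-* _ _ ⟩
    - (suc m ×′ 1#) * - (suc n ×′ 1#)   ∎

  morphism : ℤ.+-*-rawRing -Raw-AlmostCommutative⟶ fromCommutativeRing R
  morphism = record
    { ⟦_⟧ = ⟦_⟧ ; +-homo = ⟦+⟧ ; *-homo = ⟦*⟧ ; -‿homo = ⟦-⟧
    ; 0-homo = refl ; 1-homo = refl }

  dec : ∀ i j → Maybe (⟦ i ⟧ ≈ ⟦ j ⟧)
  dec i j with i ℤ.≟ j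
  ... | yes i≡j = just (reflexive (≡.cong ⟦_⟧ i≡j))
  ... | no  _   = nothing

  open RingSolver ℤ.+-*-rawRing (fromCommutativeRing R) morphism dec public
    using (solve; _:=_; _:+_; _:*_; _:-_; :-_; con; Polynomial)

  -- The bracketing mirrors the unfolding of `fromℕ`, so `:2` and `:4` denote `fromℕ 2` and
  -- `fromℕ 4` definitionally.
  :0 :1 :2 :4 : ∀ {n} → Polynomial n
  :0 = con (ℤ.+ 0)
  :1 = con (ℤ.+ 1)
  :2 = :1 :+ (:1 :+ :0)
  :4 = :1 :+ (:1 :+ :2)


-- Arithmetic of inequalities in the ordered field.

module OrderedField (𝓡 : CompleteOrderedField) where
  open CompleteOrderedField 𝓡
  open IntegerCoefficients commutativeRing public

  private module ≤ = IsDecTotalOrder isDecTotalOrder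

  ≤-refl : ∀ {x} → x ≤ x
  ≤-refl = ≤.refl

  ≤-reflexive : ∀ {x y} → x ≈ y → x ≤ y
  ≤-reflexive = ≤.reflexive

  ≤-trans : ∀ {x y z} → x ≤ y → y ≤ z → x ≤ z
  ≤-trans = ≤.trans

  ≤-antisym : ∀ {x y} → x ≤ y → y ≤ x → x ≈ y
  ≤-antisym = ≤.antisym

  ≤-total : ∀ x y → x ≤ y ⊎ y ≤ x
  ≤-total = ≤.total

  _≟_ : ∀ x y → Dec (x ≈ y)
  _≟_ = ≤._≟_

  ≤-stable : ∀ {x y} → ¬ ¬ x ≤ y → x ≤ y
  ≤-stable {x} {y} = decidable-stable (x ≤? y)

  ≰⇒≥ : ∀ {x y} → ¬ x ≤ y → y ≤ x
  ≰⇒≥ {x} {y} x≰y with ≤-total x y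
  ... | inj₁ x≤y = ⊥-elim (x≰y x≤y)
  ... | inj₂ y≤x = y≤x

  ≰⇒> : ∀ {x y} → ¬ x ≤ y → y < x
  ≰⇒> x≰y = ≰⇒≥ x≰y , λ y≈x → x≰y (≤-reflexive (sym y≈x))

  <⇒≱ : ∀ {x y} → x < y → ¬ y ≤ x
  <⇒≱ (x≤y , x≉y) y≤x = x≉y (≤-antisym x≤y y≤x)

  -- Inequalities are proved by exhibiting a non-negative difference d and
  -- leaving the identity x + d ≈ y to the ring solver.
  difference : ∀ {d x y} → 0# ≤ d → x + d ≈ y → x ≤ y
  difference {d} {x} {y} 0≤d x+d≈y =
    ≤-trans (≤-reflexive (sym (+-identityʳ x)))
            (≤-trans (+-monoʳ-≤ x 0≤d) (≤-reflexive x+d≈y))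

  0≤- : ∀ {x y} → x ≤ y → 0# ≤ y - x
  0≤- {x} {y} x≤y =
    ≤-trans (≤-reflexive (solve 1 (λ x → :0 := :- x :+ x) refl x))
            (≤-trans (+-monoʳ-≤ (- x) x≤y) (≤-reflexive (+-comm (- x) y)))

  0≤≈ : ∀ {x y} → x ≈ y → 0# ≤ y - x
  0≤≈ x≈y = 0≤- (≤-reflexive x≈y)

  infixl 6 _⊕_
  infixl 7 _⊗_

  _⊕_ : ∀ {x y} → 0# ≤ x → 0# ≤ y → 0# ≤ x + y
  _⊕_ {x} {y} 0≤x 0≤y =
    ≤-trans 0≤x (difference 0≤y refl)

  _⊗_ : ∀ {x y} → 0# ≤ x → 0# ≤ y → 0# ≤ x * y
  _⊗_ = *-nonNegative

  -- Lets an equation enter a `difference` proof as a summand equal to zero. The multiplier `z` may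
  -- have any sign and is chosen so that the solver's identity closes.
  0≤* : ∀ z {x y} → x ≈ y → 0# ≤ z * (x - y)
  0≤* z {x} {y} x≈y = ≤-reflexive (begin
    0#            ≈⟨ solve 2 (λ z x → :0 := z :* (x :- x)) refl z x ⟩
    z * (x - x)   ≈⟨ *-congˡ (+-congˡ (-‿cong x≈y)) ⟩
    z * (x - y)   ∎)
    where open import Relation.Binary.Reasoning.Setoid setoid

  +-mono-≤ : ∀ {x y u v} → x ≤ y → u ≤ v → x + u ≤ y + v
  +-mono-≤ {x} {y} {u} {v} x≤y u≤v = difference (0≤- x≤y ⊕ 0≤- u≤v)
    (solve 4 (λ x y u v → x :+ u :+ (y :- x :+ (v :- u)) := y :+ v) refl x y u v)

  *-monoˡ-≤ : ∀ {z x y} → 0# ≤ z → x ≤ y → z * x ≤ z * y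
  *-monoˡ-≤ {z} {x} {y} 0≤z x≤y = difference (0≤z ⊗ 0≤- x≤y)
    (solve 3 (λ z x y → z :* x :+ z :* (y :- x) := z :* y) refl z x y)

  *-mono-≤ : ∀ {x y u v} → 0# ≤ x → x ≤ y → 0# ≤ u → u ≤ v → x * u ≤ y * v
  *-mono-≤ {x} {y} {u} {v} 0≤x x≤y 0≤u u≤v =
    difference (0≤- x≤y ⊗ 0≤u ⊕ (≤-trans 0≤x x≤y) ⊗ 0≤- u≤v)
      (solve 4 (λ x y u v → x :* u :+ ((y :- x) :* u :+ y :* (v :- u)) := y :* v) refl x y u v)

  0≤square : ∀ x → 0# ≤ x * x
  0≤square x with ≤-total 0# x
  ... | inj₁ 0≤x = 0≤x ⊗ 0≤x
  ... | inj₂ x≤0 = difference (0≤- x≤0 ⊗ 0≤- x≤0)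
    (solve 1 (λ x → :0 :+ (:0 :- x) :* (:0 :- x) := x :* x) refl x)

  0≤1 : 0# ≤ 1#
  0≤1 = ≤-trans (0≤square 1#) (≤-reflexive (*-identityʳ 1#))

  0<1 : 0# < 1#
  0<1 = 0≤1 , 0≉1

  0≤2 : 0# ≤ 1# + 1#
  0≤2 = 0≤1 ⊕ 0≤1

  pos⇒≉0 : ∀ {x} → 0# < x → ¬ x ≈ 0#
  pos⇒≉0 (_ , 0≉x) x≈0 = 0≉x (sym x≈0)

  pos-≤ : ∀ {x y} → 0# < x → x ≤ y → 0# < y
  pos-≤ 0<x x≤y = ≰⇒> λ y≤0 → <⇒≱ 0<x (≤-trans x≤y y≤0)

  0<- : ∀ {x y} → x < y → 0# < y - x
  0<- {x} {y} x<y = ≰⇒> λ y-x≤0 → <⇒≱ x<y (difference (0≤- y-x≤0)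
    (solve 2 (λ x y → y :+ (:0 :- (y :- x)) := x) refl x y))

  0<*⁻¹ : ∀ {x} → 0# < x → 0# < x ⁻¹
  0<*⁻¹ {x} 0<x = ≰⇒> λ x⁻¹≤0 → <⇒≱ 0<1 (difference
    (0≤- x⁻¹≤0 ⊗ proj₁ 0<x ⊕ 0≤* 1# (⁻¹-inverseʳ (pos⇒≉0 0<x)))
    (solve 2 (λ x y → :1 :+ ((:0 :- y) :* x :+ :1 :* (x :* y :- :1)) := :0) refl x (x ⁻¹)))

  *-⁻¹ : ∀ {x} → 0# < x → x * x ⁻¹ ≈ 1#
  *-⁻¹ 0<x = ⁻¹-inverseʳ (pos⇒≉0 0<x)

  *-cancelˡ-≤ : ∀ {z x y} → 0# < z → z * x ≤ z * y → x ≤ y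
  *-cancelˡ-≤ {z} {x} {y} 0<z zx≤zy = difference
    (proj₁ (0<*⁻¹ 0<z) ⊗ 0≤- zx≤zy ⊕ 0≤* (y - x) (sym (*-⁻¹ 0<z)))
    (solve 4 (λ z w x y →
        x :+ (w :* (z :* y :- z :* x) :+ (y :- x) :* (:1 :- z :* w)) := y)
      refl z (z ⁻¹) x y)

  0<* : ∀ {x y} → 0# < x → 0# < y → 0# < x * y
  0<* {x} {y} 0<x 0<y = ≰⇒> λ xy≤0 →
    <⇒≱ 0<y (*-cancelˡ-≤ 0<x (≤-trans xy≤0 (≤-reflexive (sym (zeroʳ x)))))

  *-⁻¹-unique : ∀ {x y} → 0# < x → x * y ≈ 1# → y ≈ x ⁻¹
  *-⁻¹-unique {x} {y} 0<x xy≈1 = ≤-antisym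
    (*-cancelˡ-≤ 0<x (≤-reflexive (trans xy≈1 (sym (*-⁻¹ 0<x)))))
    (*-cancelˡ-≤ 0<x (≤-reflexive (trans (*-⁻¹ 0<x) (sym xy≈1))))

  ⊔-case : ∀ (Q : ℝ → Set) x y → Q x → Q y → Q (x ⊔ y)
  ⊔-case Q x y Qx Qy with ≤-total y x
  ... | inj₁ _ = Qx
  ... | inj₂ _ = Qy

  x≤x⊔y : ∀ x y → x ≤ x ⊔ y
  x≤x⊔y x y with ≤-total y x
  ... | inj₁ _   = ≤-refl
  ... | inj₂ x≤y = x≤y

  y≤x⊔y : ∀ x y → y ≤ x ⊔ y
  y≤x⊔y x y with ≤-total y x
  ... | inj₁ y≤x = y≤x
  ... | inj₂ _   = ≤-refl

  0≤fromℕ : ∀ n → 0# ≤ fromℕ n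
  0≤fromℕ zero    = ≤-refl
  0≤fromℕ (suc n) = 0≤1 ⊕ 0≤fromℕ n

  0<fromℕ-suc : ∀ n → 0# < fromℕ (suc n)
  0<fromℕ-suc n = pos-≤ 0<1 (difference (0≤fromℕ n) refl)

  -- The Archimedean property: if the naturals were bounded, their supremum less `1#` would bound
  -- them as well, because every successor lies below the supremum.
  fromℕ-unbounded : ∀ u → ¬ (∀ n → fromℕ n ≤ u)
  fromℕ-unbounded u fromℕ≤u =
    <⇒≱ 0<1 (difference (0≤- (least _ λ { x (n , x≈n) → step n x≈n }))
      (solve 1 (λ s → :1 :+ (s :- :1 :- s) := :0) refl (⨆ Naturals)))
    where
    Naturals : ℝ → Set
    Naturals x = ∃ λ n → x ≈ fromℕ n

    isLub : IsLub Naturals (⨆ Naturals)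
    isLub = ⨆-isLub Naturals (0# , 0 , refl)
      (u , λ { x (n , x≈n) → ≤-trans (≤-reflexive x≈n) (fromℕ≤u n) })

    least = proj₂ isLub

    step : ∀ n {x} → x ≈ fromℕ n → x ≤ ⨆ Naturals - 1#
    step n {x} x≈n = ≤-trans (≤-reflexive x≈n)
      (difference (0≤- (proj₁ isLub (fromℕ (suc n)) (suc n , refl)))
        (solve 2 (λ n s → n :+ (s :- (:1 :+ n)) := s :- :1) refl (fromℕ n) (⨆ Naturals)))

  0≤^ : ∀ {x} n → 0# ≤ x → 0# ≤ x ^ n
  0≤^ zero    0≤x = 0≤1
  0≤^ (suc n) 0≤x = 0≤x ⊗ 0≤^ n 0≤x

  0<^ : ∀ {x} n → 0# < x → 0# < x ^ n
  0<^ zero    0<x = 0<1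
  0<^ (suc n) 0<x = 0<* 0<x (0<^ n 0<x)

  ^-mono-≤ : ∀ {x y} n → 0# ≤ x → x ≤ y → x ^ n ≤ y ^ n
  ^-mono-≤ zero    0≤x x≤y = ≤-refl
  ^-mono-≤ (suc n) 0≤x x≤y = *-mono-≤ 0≤x x≤y (0≤^ n 0≤x) (^-mono-≤ n 0≤x x≤y)

  0<*ˡ : ∀ {x y} → 0# ≤ x → 0# < x * y → 0# < x
  0<*ˡ {x} {y} 0≤x 0<xy = 0≤x , λ 0≈x → proj₂ 0<xy (trans (sym (zeroˡ y)) (*-congʳ 0≈x))

  0<*ʳ : ∀ {x y} → 0# ≤ y → 0# < x * y → 0# < y
  0<*ʳ {x} {y} 0≤y 0<xy = 0≤y , λ 0≈y → proj₂ 0<xy (trans (sym (zeroʳ x)) (*-congˡ 0≈y))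

  -- Meant for a transition probability `c`: jumps are bounded only along transitions of positive
  -- probability, and the others contribute nothing to a mean.
  *-monoˡ-≤-pos : ∀ {c x y} → 0# ≤ c → (0# < c → x ≤ y) → c * x ≤ c * y
  *-monoˡ-≤-pos {c} {x} {y} 0≤c x≤y with 0# ≟ c
  ... | no  0≉c = *-monoˡ-≤ 0≤c (x≤y (0≤c , 0≉c))
  ... | yes 0≈c = ≤-reflexive
    (trans (*-congʳ (sym 0≈c)) (trans (trans (zeroˡ x) (sym (zeroˡ y))) (*-congʳ 0≈c)))

  *-cancelˡ-≈ : ∀ {z x y} → 0# < z → z * x ≈ z * y → x ≈ y
  *-cancelˡ-≈ 0<z eq =
    ≤-antisym (*-cancelˡ-≤ 0<z (≤-reflexive eq)) (*-cancelˡ-≤ 0<z (≤-reflexive (sym eq)))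

  *-/-cancel : ∀ {x y} → 0# < y → y * (x / y) ≈ x
  *-/-cancel {x} {y} 0<y = trans (solve 3 (λ x y i → y :* (x :* i) := y :* i :* x) refl x y (y ⁻¹))
    (trans (*-congʳ (*-⁻¹ 0<y)) (*-identityˡ x))

-- Unordered sums of non-negative families.

module UnorderedSums (𝓡 : CompleteOrderedField) where
  open CompleteOrderedField 𝓡
  open Analysis 𝓡
  open OrderedField 𝓡
  open import Relation.Binary.Reasoning.Setoid setoid

  private variable
    I J Z : Set
    S T : Pred I 0ℓ
    f g : I → ℝ
    r s u : ℝ

  sum : (I → ℝ) → List I → ℝ
  sum f []       = 0#
  sum f (x ∷ xs) = f x + sum f xs

  sum-++ : ∀ (f : I → ℝ) xs ys → sum f (xs ++ ys) ≈ sum f xs + sum f ys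
  sum-++ f []       ys = sym (+-identityˡ _)
  sum-++ f (x ∷ xs) ys = trans (+-congˡ (sum-++ f xs ys)) (sym (+-assoc _ _ _))

  sum-map : ∀ (f : I → ℝ) (φ : J → I) xs → sum f (map φ xs) ≡ sum (f ∘ φ) xs
  sum-map f φ []       = ≡.refl
  sum-map f φ (x ∷ xs) = ≡.cong (f (φ x) +_) (sum-map f φ xs)

  sum-+ : ∀ (f g : I → ℝ) xs → sum (λ x → f x + g x) xs ≈ sum f xs + sum g xs
  sum-+ f g []       = sym (+-identityˡ _)
  sum-+ f g (x ∷ xs) = trans (+-congˡ (sum-+ f g xs))
    (solve 4 (λ a b c d → a :+ b :+ (c :+ d) := a :+ c :+ (b :+ d)) refl (f x) (g x) _ _)

  sum-* : ∀ c (f : I → ℝ) xs → sum (λ x → c * f x) xs ≈ c * sum f xs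
  sum-* c f []       = sym (zeroʳ c)
  sum-* c f (x ∷ xs) = trans (+-congˡ (sum-* c f xs)) (sym (distribˡ c _ _))

  sum-mono : (∀ x → S x → f x ≤ g x) → ∀ {xs} → All S xs → sum f xs ≤ sum g xs
  sum-mono f≤g []         = ≤-refl
  sum-mono f≤g (Sx ∷ Sxs) = +-mono-≤ (f≤g _ Sx) (sum-mono f≤g Sxs)

  0≤sum : (∀ x → S x → 0# ≤ f x) → ∀ {xs} → All S xs → 0# ≤ sum f xs
  0≤sum 0≤f []         = ≤-refl
  0≤sum 0≤f (Sx ∷ Sxs) = 0≤f _ Sx ⊕ 0≤sum 0≤f Sxs

  -- Each element of `xs` is cut out of `ys` in turn; uniqueness of `xs` keeps its remaining
  -- elements inside what is left.
  sum-⊆ : (∀ x → S x → 0# ≤ f x) → ∀ {xs ys} → All S ys →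
          Unique xs → xs ⊆ ys → sum f xs ≤ sum f ys
  sum-⊆ 0≤f Sys []            xs⊆ys = 0≤sum 0≤f Sys
  sum-⊆ {f = f} 0≤f {x ∷ xs} Sys (x∉xs ∷ xs!) xs⊆ys with ∈-∃++ (xs⊆ys (here ≡.refl))
  ... | as , bs , ≡.refl = ≤-trans
    (+-mono-≤ ≤-refl (sum-⊆ 0≤f (All.++⁺ (All.++⁻ˡ as Sys) (All.tail (All.++⁻ʳ as Sys))) xs! xs⊆))
    (≤-reflexive (begin
      f x + sum f (as ++ bs)         ≈⟨ +-congˡ (sum-++ f as bs) ⟩
      f x + (sum f as + sum f bs)    ≈⟨ solve 3 (λ a b c → a :+ (b :+ c) := b :+ (a :+ c)) refl _ _ _ ⟩
      sum f as + (f x + sum f bs)    ≈⟨ sym (sum-++ f as (x ∷ bs)) ⟩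
      sum f (as ++ x ∷ bs)           ∎))
    where
    xs⊆ : xs ⊆ as ++ bs
    xs⊆ z∈xs with ∈-++⁻ as (xs⊆ys (there z∈xs))
    ... | inj₁ z∈as           = ∈-++⁺ˡ z∈as
    ... | inj₂ (there z∈bs)   = ∈-++⁺ʳ as z∈bs
    ... | inj₂ (here ≡.refl)  = ⊥-elim (All.lookup x∉xs z∈xs ≡.refl)

  All-U : ∀ (xs : List I) → All U xs
  All-U = All.universal (λ _ → _)

  Bounded : Pred I 0ℓ → (I → ℝ) → ℝ → Set
  Bounded S f u = ∀ xs → Unique xs → All S xs → sum f xs ≤ u

  -- `HasSum` with partial sums indexed directly by lists. Unlike an equation about `∑`, the
  -- relation carries the boundedness that makes `∑` meaningful.
  record Sum {I : Set} (S : Pred I 0ℓ) (f : I → ℝ) (r : ℝ) : Set where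
    field
      upper : Bounded S f r
      least : ∀ u → Bounded S f u → r ≤ u
  open Sum public

  sum≡foldr : ∀ (f : I → ℝ) xs → sum f xs ≡ foldr _+_ 0# (map f xs)
  sum≡foldr f []       = ≡.refl
  sum≡foldr f (x ∷ xs) = ≡.cong (f x +_) (sum≡foldr f xs)

  Bounded⇒IsUpperBound : Bounded S f u → IsUpperBound (FiniteSum S f) u
  Bounded⇒IsUpperBound {f = f} b r (xs , xs! , Sxs , r≈) =
    ≤-trans (≤-reflexive (trans r≈ (reflexive (≡.sym (sum≡foldr f xs))))) (b xs xs! Sxs)

  IsUpperBound⇒Bounded : IsUpperBound (FiniteSum S f) u → Bounded S f u
  IsUpperBound⇒Bounded {f = f} b xs xs! Sxs = b _ (xs , xs! , Sxs , reflexive (sum≡foldr f xs))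

  Sum⇒HasSum : Sum S f r → HasSum S f r
  Sum⇒HasSum f≈r = Bounded⇒IsUpperBound (upper f≈r) , λ u b → least f≈r u (IsUpperBound⇒Bounded b)

  HasSum⇒Sum : HasSum S f r → Sum S f r
  HasSum⇒Sum (ub , lub) = record
    { upper = IsUpperBound⇒Bounded ub
    ; least = λ u b → lub u (Bounded⇒IsUpperBound b) }

  Sum-∑ : Bounded S f u → Sum S f (∑ S f)
  Sum-∑ {S = S} {f = f} {u = u} b = HasSum⇒Sum
    (⨆-isLub (FiniteSum S f) (0# , [] , [] , [] , refl) (u , Bounded⇒IsUpperBound b))

  ∑-≤ : Bounded S f u → ∑ S f ≤ u
  ∑-≤ b = least (Sum-∑ b) _ b

  Sum-unique : Sum S f r → Sum S f s → r ≈ s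
  Sum-unique p q = ≤-antisym (least p _ (upper q)) (least q _ (upper p))

  Sum⇒∑ : Sum S f r → ∑ S f ≈ r
  Sum⇒∑ p = Sum-unique (Sum-∑ (upper p)) p

  0≤Sum : Sum S f r → 0# ≤ r
  0≤Sum p = upper p [] [] []

  term≤Sum : Sum S f r → ∀ x → S x → f x ≤ r
  term≤Sum p x Sx = ≤-trans (≤-reflexive (sym (+-identityʳ _))) (upper p (x ∷ []) ([] ∷ []) (Sx ∷ []))

  Bounded-mono : (∀ x → S x → f x ≤ g x) → Bounded S g u → Bounded S f u
  Bounded-mono f≤g b xs xs! Sxs = ≤-trans (sum-mono f≤g Sxs) (b xs xs! Sxs)

  Bounded-≤ : r ≤ s → Bounded S f r → Bounded S f s
  Bounded-≤ r≤s b xs xs! Sxs = ≤-trans (b xs xs! Sxs) r≤s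

  Bounded-⊆ : (∀ x → S x → T x) → Bounded T f u → Bounded S f u
  Bounded-⊆ S⊆T b xs xs! Sxs = b xs xs! (All.map (λ {x} → S⊆T x) Sxs)

  Bounded-+ : Bounded S f r → Bounded S g s → Bounded S (λ x → f x + g x) (r + s)
  Bounded-+ p q xs xs! Sxs =
    ≤-trans (≤-reflexive (sum-+ _ _ xs)) (+-mono-≤ (p xs xs! Sxs) (q xs xs! Sxs))

  Bounded-* : ∀ {c} → 0# ≤ c → Bounded S f u → Bounded S (λ x → c * f x) (c * u)
  Bounded-* 0≤c b xs xs! Sxs =
    ≤-trans (≤-reflexive (sum-* _ _ xs)) (*-monoˡ-≤ 0≤c (b xs xs! Sxs))

  Sum-≤ : Sum S f r → (∀ x → S x → f x ≤ g x) → Bounded S g u → r ≤ u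
  Sum-≤ p f≤g b = least p _ (Bounded-mono f≤g b)

  Sum-cong : (∀ x → S x → f x ≈ g x) → r ≈ s → Sum S f r → Sum S g s
  Sum-cong f≈g r≈s p = record
    { upper = Bounded-≤ (≤-reflexive r≈s)
        (Bounded-mono (λ x Sx → ≤-reflexive (sym (f≈g x Sx))) (upper p))
    ; least = λ u b → ≤-trans (≤-reflexive (sym r≈s))
        (Sum-≤ p (λ x Sx → ≤-reflexive (f≈g x Sx)) b) }

  Sum-⇔ : (∀ x → S x → T x) → (∀ x → T x → S x) → Sum S f r → Sum T f r
  Sum-⇔ S⇒T T⇒S p = record
    { upper = Bounded-⊆ T⇒S (upper p)
    ; least = λ u b → least p u (Bounded-⊆ S⇒T b) }

  Sum-0 : Sum S (λ _ → 0#) 0#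
  Sum-0 = record
    { upper = λ xs _ _ → ≤-reflexive (sum-0 xs)
    ; least = λ u b → b [] [] [] }
    where
    sum-0 : ∀ (xs : List I) → sum (λ _ → 0#) xs ≈ 0#
    sum-0 []       = refl
    sum-0 (x ∷ xs) = trans (+-identityˡ _) (sum-0 xs)

  -- Zero is split off because leastness is proved by dividing a given bound by `c`.
  Sum-* : ∀ {c} → 0# ≤ c → Sum S f r → Sum S (λ x → c * f x) (c * r)
  Sum-* {f = f} {r = r} {c = c} 0≤c p with c ≟ 0#
  ... | yes c≈0 = Sum-cong (λ x _ → sym (trans (*-congʳ c≈0) (zeroˡ _)))
                           (sym (trans (*-congʳ c≈0) (zeroˡ _))) Sum-0
  ... | no  c≉0 = record
    { upper = Bounded-* 0≤c (upper p)
    ; least = λ u b → ≤-trans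
        (*-monoˡ-≤ 0≤c (least p (c ⁻¹ * u) λ xs xs! Sxs → *-cancelˡ-≤ 0<c
          (≤-trans (≤-reflexive (sym (sum-* c f xs)))
                   (≤-trans (b xs xs! Sxs) (≤-reflexive (sym (c*c⁻¹*u u)))))))
        (≤-reflexive (c*c⁻¹*u u)) }
    where
    0<c : 0# < c
    0<c = 0≤c , λ 0≈c → c≉0 (sym 0≈c)
    c*c⁻¹*u : ∀ u → c * (c ⁻¹ * u) ≈ u
    c*c⁻¹*u u = trans (sym (*-assoc _ _ _)) (trans (*-congʳ (⁻¹-inverseʳ c≉0)) (*-identityˡ u))

  -- Two finite partial sums, one of f and one of g, are dominated by the
  -- partial sum of f + g over the union of their index lists.
  Sum-+ : DecidableEquality I → {S : Pred I 0ℓ} →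
          (∀ x → S x → 0# ≤ f x) → (∀ x → S x → 0# ≤ g x) →
          Sum S f r → Sum S g s → Sum S (λ x → f x + g x) (r + s)
  Sum-+ {f = f} {g = g} {r = r} {s = s} _≟ᴵ_ {S} 0≤f 0≤g p q = record
    { upper = Bounded-+ (upper p) (upper q)
    ; least = λ u b → difference
        (0≤- (least p (u - s) λ xs xs! Sxs → difference
          (0≤- (least q (u - sum f xs) λ ys ys! Sys → both u b xs xs! Sxs ys ys! Sys))
          (solve 3 (λ a s u → a :+ (u :- a :- s) := u :- s) refl (sum f xs) s u)))
        (solve 3 (λ r s u → r :+ s :+ (u :- s :- r) := u) refl r s u) }
    where
    both : ∀ u → Bounded S (λ x → f x + g x) u →
           ∀ xs → Unique xs → All S xs → ∀ ys → Unique ys → All S ys →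
           sum g ys ≤ u - sum f xs
    both u b xs xs! Sxs ys ys! Sys = difference
      (0≤- (b zs (deduplicate-! _≟ᴵ_ (xs ++ ys)) Szs)
        ⊕ 0≤- (sum-⊆ 0≤f Szs xs! λ z∈xs → ∈-deduplicate⁺ _≟ᴵ_ (∈-++⁺ˡ z∈xs))
        ⊕ 0≤- (sum-⊆ 0≤g Szs ys! λ z∈ys → ∈-deduplicate⁺ _≟ᴵ_ (∈-++⁺ʳ xs z∈ys))
        ⊕ 0≤≈ (sym (sum-+ f g zs)))
      (solve 6 (λ a b a′ b′ c u →
          b :+ (u :- c :+ (a′ :- a) :+ (b′ :- b) :+ (c :- (a′ :+ b′))) := u :- a)
        refl (sum f xs) (sum g ys) (sum f zs) (sum g zs) (sum (λ x → f x + g x) zs) u)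
      where
      zs  = deduplicate _≟ᴵ_ (xs ++ ys)
      Szs = All.deduplicate⁺ _≟ᴵ_ (All.++⁺ Sxs Sys)

  Sum-sum : DecidableEquality J → {T : Pred J 0ℓ} {F : I → J → ℝ} {a : I → ℝ} →
            (∀ i j → S i → T j → 0# ≤ F i j) → (∀ i → S i → Sum T (F i) (a i)) →
            ∀ {xs} → All S xs → Sum T (λ j → sum (λ i → F i j) xs) (sum a xs)
  Sum-sum _≟ᴶ_ 0≤F p []         = Sum-0
  Sum-sum _≟ᴶ_ 0≤F p (Sx ∷ Sxs) =
    Sum-+ _≟ᴶ_ (λ j Tj → 0≤F _ j Sx Tj) (λ j Tj → 0≤sum (λ i Si → 0≤F i j Si Tj) Sxs)
      (p _ Sx) (Sum-sum _≟ᴶ_ 0≤F p Sxs)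

  -- Tonelli's theorem. Finitely many columns are added inside each row by `Sum-sum`, and the result
  -- is at most the row sums; the transposed argument gives the other inequality.
  Sum-swap : DecidableEquality I → DecidableEquality J →
             {S : Pred I 0ℓ} {T : Pred J 0ℓ} {F : I → J → ℝ} {a : I → ℝ} {b : J → ℝ} →
             (∀ i j → S i → T j → 0# ≤ F i j) →
             (∀ i → S i → Sum T (F i) (a i)) → (∀ j → T j → Sum S (λ i → F i j) (b j)) →
             Sum S a r → Sum T b r
  Sum-swap _≟ᴵ_ _≟ᴶ_ 0≤F p q t = record
    { upper = λ ys ys! Tys → Sum-≤ (Sum-sum _≟ᴵ_ (λ j i Tj Si → 0≤F i j Si Tj) q Tys)
        (λ i Si → upper (p i Si) ys ys! Tys) (upper t)
    ; least = λ u b → least t u λ xs xs! Sxs → Sum-≤ (Sum-sum _≟ᴶ_ 0≤F p Sxs)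
        (λ j Tj → upper (q j Tj) xs xs! Sxs) b }

  when : {P : Set} → Dec P → ℝ → ℝ
  when (yes _) x = x
  when (no  _) x = 0#

  when-yes : ∀ {P : Set} (P? : Dec P) x → P → when P? x ≈ x
  when-yes (yes _) x p = refl
  when-yes (no ¬p) x p = ⊥-elim (¬p p)

  when-no : ∀ {P : Set} (P? : Dec P) x → ¬ P → when P? x ≈ 0#
  when-no (yes p) x ¬p = ⊥-elim (¬p p)
  when-no (no  _) x ¬p = refl

  0≤when : ∀ {P : Set} (P? : Dec P) {x} → 0# ≤ x → 0# ≤ when P? x
  0≤when (yes _) 0≤x = 0≤x
  0≤when (no  _) 0≤x = ≤-refl

  sum-when : (S? : Decidable S) → ∀ xs → sum (λ x → when (S? x) (f x)) xs ≈ sum f (filter S? xs)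
  sum-when S? []       = refl
  sum-when S? (x ∷ xs) with S? x
  ... | yes _ = +-congˡ (sum-when S? xs)
  ... | no  _ = trans (+-identityˡ _) (sum-when S? xs)

  Sum-when : {T : Pred I 0ℓ} (S? : Decidable S) →
             Sum (T ∩ S) f r → Sum T (λ x → when (S? x) (f x)) r
  Sum-when {S = S} {f = f} {T = T} S? p = record
    { upper = λ xs xs! Txs → ≤-trans (≤-reflexive (sum-when S? xs))
        (upper p (filter S? xs) (Unique.filter⁺ S? xs!)
          (All.zip (All.filter⁺ S? Txs , All.all-filter S? xs)))
    ; least = λ u b → Sum-≤ p (λ x TSx → ≤-reflexive (sym (when-yes (S? x) _ (proj₂ TSx))))
        (Bounded-⊆ (λ x → proj₁) b) }

  Sum-point : ∀ x → S x → (∀ y → S y → y ≡ x) → 0# ≤ f x → Sum S f (f x)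
  Sum-point {S = S} {f = f} x Sx S⇒≡x 0≤fx = record
    { upper = λ
      { []           _    _  → 0≤fx
      ; (y ∷ [])     _    (Sy ∷ _) → ≤-reflexive (trans (+-identityʳ _) (reflexive (≡.cong f (S⇒≡x y Sy))))
      ; (y ∷ z ∷ _)  ((y≢z ∷ _) ∷ _) (Sy ∷ Sz ∷ _) → ⊥-elim (y≢z (≡.trans (S⇒≡x y Sy) (≡.sym (S⇒≡x z Sz)))) }
    ; least = λ u b → ≤-trans (≤-reflexive (sym (+-identityʳ _))) (b (x ∷ []) ([] ∷ []) (Sx ∷ [])) }

  Sum-split : DecidableEquality I → {S T : Pred I 0ℓ} (S? : Decidable S) →
              (∀ x → T x → 0# ≤ f x) →
              Sum (T ∩ S) f r → Sum (T ∩ ∁ S) f s → Sum T f (r + s)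
  Sum-split {f = f} _≟ᴵ_ S? 0≤f p q = Sum-cong
    (λ x _ → combine x) refl
    (Sum-+ _≟ᴵ_ (λ x Tx → 0≤when (S? x) (0≤f x Tx)) (λ x Tx → 0≤when (¬? (S? x)) (0≤f x Tx))
      (Sum-when S? p) (Sum-when (λ x → ¬? (S? x)) q))
    where
    combine : ∀ x → when (S? x) (f x) + when (¬? (S? x)) (f x) ≈ f x
    combine x with S? x
    ... | yes _ = +-identityʳ _
    ... | no  _ = +-identityˡ _

  -- Tonelli applied to `f` times the indicator of the graph of `π`: every `z` lies in exactly one
  -- fibre.
  Sum-fiber : DecidableEquality I → DecidableEquality Z →
              {S : Pred Z 0ℓ} {T : Pred I 0ℓ} (π : Z → I) {a : I → ℝ} →
              (∀ z → S z → T (π z)) → (∀ z → S z → 0# ≤ f z) →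
              (∀ i → T i → Sum (S ∩ (λ z → π z ≡ i)) f (a i)) →
              Sum T a r → Sum S f r
  Sum-fiber {f = f} _≟ᴵ_ _≟ᶻ_ π S⇒T 0≤f p t = Sum-swap _≟ᴵ_ _≟ᶻ_
    {F = λ i z → when (π z ≟ᴵ i) (f z)}
    (λ i z _ Sz → 0≤when (π z ≟ᴵ i) (0≤f z Sz))
    (λ i Ti → Sum-when (λ z → π z ≟ᴵ i) (p i Ti))
    (λ z Sz → Sum-when (λ i → π z ≟ᴵ i)
      (Sum-point (π z) (S⇒T z Sz , ≡.refl) (λ y Ty → ≡.sym (proj₂ Ty)) (0≤f z Sz)))
    t

  Sum-reindex : {S : Pred I 0ℓ} {T : Pred J 0ℓ} (φ : J → I) →
                (∀ {i j} → φ i ≡ φ j → i ≡ j) →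
                (∀ j → T j → S (φ j)) → (∀ i → S i → ∃ λ j → T j × φ j ≡ i) →
                Sum T (f ∘ φ) r → Sum S f r
  Sum-reindex {f = f} {S = S} {T} φ φ-injective T⇒S preimage p = record
    { upper = λ xs xs! Sxs → let ys , Tys , φys≡xs = pull Sxs in
        ≤-trans (≤-reflexive (reflexive (≡.trans (≡.cong (sum f) (≡.sym φys≡xs)) (sum-map f φ ys))))
                (upper p ys (Unique.map⁻ (≡.subst Unique (≡.sym φys≡xs) xs!)) Tys)
    ; least = λ u b → least p u λ ys ys! Tys →
        ≤-trans (≤-reflexive (reflexive (≡.sym (sum-map f φ ys))))
                (b (map φ ys) (Unique.map⁺ φ-injective ys!) (All.map⁺ (All.map (λ {j} → T⇒S j) Tys))) }
    where
    pull : ∀ {xs} → All S xs → ∃ λ ys → All T ys × map φ ys ≡ xs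
    pull []         = [] , [] , ≡.refl
    pull (Sx ∷ Sxs) with preimage _ Sx | pull Sxs
    ... | y , Ty , ≡.refl | ys , Tys , ≡.refl = y ∷ ys , Ty ∷ Tys , ≡.refl

  Sum-shift : {f : ℕ → ℝ} → (∀ n → 0# ≤ f n) → Sum U (f ∘ suc) r → Sum U f (f 0 + r)
  Sum-shift {f = f} 0≤f p = Sum-split ℕ._≟_ {S = _≡ 0} (ℕ._≟ 0) (λ n _ → 0≤f n)
    (Sum-point 0 (_ , ≡.refl) (λ _ → proj₂) (0≤f 0))
    (Sum-reindex suc ℕ.suc-injective (λ _ _ → _ , λ ())
      (λ { zero (_ , n≢0) → ⊥-elim (n≢0 ≡.refl) ; (suc n) _ → n , _ , ≡.refl }) p)

  -- Every finite set of naturals lies in an initial segment.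
  partialSums⇒Bounded : {f : ℕ → ℝ} → (∀ n → 0# ≤ f n) →
                        (∀ n → sum f (downFrom n) ≤ u) → Bounded U f u
  partialSums⇒Bounded 0≤f b xs xs! _ with bound xs
    where
    bound : ∀ xs → ∃ λ n → All (ℕ._< n) xs
    bound []       = 0 , []
    bound (x ∷ xs) with bound xs
    ... | n , xs<n = suc x ℕ.+ n , ℕ.m≤m+n (suc x) n ∷ All.map (λ y<n → ℕ.≤-trans y<n (ℕ.m≤n+m n (suc x))) xs<n
  ... | n , xs<n = ≤-trans
    (sum-⊆ (λ k _ → 0≤f k) (All-U (downFrom n)) xs! (λ z∈xs → ∈-downFrom⁺ (All.lookup xs<n z∈xs)))
    (b n)

  partialSum≤Sum : {f : ℕ → ℝ} → Sum U f r → ∀ n → sum f (downFrom n) ≤ r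
  partialSum≤Sum p n = upper p (downFrom n) (Unique.downFrom⁺ n) (All-U (downFrom n))

-- Chains killed on a set: survival, hitting and mean hitting times.

module KilledChain (𝓡 : CompleteOrderedField) where
  open CompleteOrderedField 𝓡
  open Analysis 𝓡
  open Chains 𝓡
  open OrderedField 𝓡
  open UnorderedSums 𝓡
  open import Relation.Binary.Reasoning.Setoid setoid

  sum-downFrom-suc : ∀ (f : ℕ → ℝ) n → sum f (downFrom (suc n)) ≈ f 0 + sum (f ∘ suc) (downFrom n)
  sum-downFrom-suc f zero    = refl
  sum-downFrom-suc f (suc n) = trans (+-congˡ (sum-downFrom-suc f n))
    (solve 3 (λ a b c → a :+ (b :+ c) := b :+ (a :+ c)) refl (f (suc n)) (f 0) _)

  module Stochastic {A : Set} (_≟ᴬ_ : DecidableEquality A) {p : Kernel A} (stochastic : IsStochastic p) where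
    open IsStochastic stochastic public

    Sum-row : ∀ x → Sum U (p x) 1#
    Sum-row x = HasSum⇒Sum (rowSum x)

    Bounded-mean : ∀ {T : Pred A 0ℓ} (g : A → ℝ) {c} x → 0# ≤ c →
                   (∀ y → T y → g y ≤ c) → Bounded T (λ y → p x y * g y) c
    Bounded-mean g {c} x 0≤c g≤c = Bounded-mono
      (λ y Ty → ≤-trans (*-monoˡ-≤ (nonNegative x y) (g≤c y Ty)) (≤-reflexive (*-comm (p x y) c)))
      (Bounded-⊆ _ (Bounded-≤ (≤-reflexive (*-identityʳ c)) (Bounded-* 0≤c (upper (Sum-row x)))))

    0≤pathWeight : ∀ x {n} (xs : Vec A n) → 0# ≤ pathWeight p x xs
    0≤pathWeight x []       = 0≤1
    0≤pathWeight x (y ∷ xs) = nonNegative x y ⊗ 0≤pathWeight y xs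

    -- First-step analysis: paths are grouped by their first state, and the weight of that step is a
    -- common factor of each group.
    Sum-paths : ∀ {n} {T : Pred A 0ℓ} {E′ : A → Pred (Vec A n) 0ℓ} {E : Pred (Vec A (suc n)) 0ℓ} →
                (∀ y ys → E (y ∷ ys) → T y × E′ y ys) → (∀ y ys → T y → E′ y ys → E (y ∷ ys)) →
                ∀ (g : A → ℝ) {x r} → (∀ y → Sum (E′ y) (pathWeight p y) (g y)) →
                Sum T (λ y → p x y * g y) r → Sum E (pathWeight p x) r
    Sum-paths E⇒ ⇒E g {x} q t = Sum-fiber _≟ᴬ_ (Vec.≡-dec _≟ᴬ_) head
      (λ { (y ∷ ys) e → proj₁ (E⇒ y ys e) }) (λ xs _ → 0≤pathWeight x xs)
      (λ y Ty → Sum-reindex (y ∷_) Vec.∷-injectiveʳ (λ ys e → ⇒E y ys Ty e , ≡.refl)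
        (λ { (y ∷ ys) (e , ≡.refl) → ys , proj₂ (E⇒ y ys e) , ≡.refl })
        (Sum-* (nonNegative x y) (q y)))
      t

    Sum-emptyPath : ∀ x → Sum U (pathWeight p x {0}) 1#
    Sum-emptyPath x = Sum-point {f = pathWeight p x} [] _ (λ { [] _ → ≡.refl }) 0≤1

    module Killed {S : Pred A 0ℓ} (S? : Decidable S) where

      -- The probability that times 1 to n avoid `S`. The recursion on the first step is the form
      -- that inductions need; `Sum-survivingPaths` links it to sums over paths.
      survive : ℕ → A → ℝ
      survive zero    x = 1#
      survive (suc n) x = ∑ (∁ S) (λ y → p x y * survive n y)

      -- The probability of avoiding `S` at times 1 to n and lying in `D` at time n + 1. The target
      -- `D` is kept apart from `S`, so that the place of entry can be recorded.
      hit : Pred A 0ℓ → ℕ → A → ℝ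
      hit D zero    x = ∑ D (p x)
      hit D (suc n) x = ∑ (∁ S) (λ y → p x y * hit D n y)

      survive≤1 : ∀ n x → survive n x ≤ 1#
      survive≤1 zero    x = ≤-refl
      survive≤1 (suc n) x = ∑-≤ (Bounded-mean (survive n) x 0≤1 λ y _ → survive≤1 n y)

      Sum-survive : ∀ n x → Sum (∁ S) (λ y → p x y * survive n y) (survive (suc n) x)
      Sum-survive n x = Sum-∑ (Bounded-mean (survive n) x 0≤1 λ y _ → survive≤1 n y)

      0≤survive : ∀ n x → 0# ≤ survive n x
      0≤survive zero    x = 0≤1
      0≤survive (suc n) x = 0≤Sum (Sum-survive n x)

      Sum-hit-zero : ∀ D x → Sum D (p x) (hit D 0 x)
      Sum-hit-zero D x = Sum-∑ (Bounded-⊆ _ (upper (Sum-row x)))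

      hit≤1 : ∀ D n x → hit D n x ≤ 1#
      hit≤1 D zero    x = ∑-≤ (Bounded-⊆ _ (upper (Sum-row x)))
      hit≤1 D (suc n) x = ∑-≤ (Bounded-mean (hit D n) x 0≤1 λ y _ → hit≤1 D n y)

      Sum-hit : ∀ D n x → Sum (∁ S) (λ y → p x y * hit D n y) (hit D (suc n) x)
      Sum-hit D n x = Sum-∑ (Bounded-mean (hit D n) x 0≤1 λ y _ → hit≤1 D n y)

      0≤hit : ∀ D n x → 0# ≤ hit D n x
      0≤hit D zero    x = 0≤Sum (Sum-hit-zero D x)
      0≤hit D (suc n) x = 0≤Sum (Sum-hit D n x)

      Sum-survivingPaths : ∀ n x → Sum (VecAll.All (∁ S)) (pathWeight p x {n}) (survive n x)
      Sum-survivingPaths zero    x = Sum-⇔ (λ { [] _ → VecAll.[] }) _ (Sum-emptyPath x)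
      Sum-survivingPaths (suc n) x = Sum-paths
        (λ { y ys (a VecAll.∷ as) → a , as }) (λ y ys → VecAll._∷_)
        (survive n) (Sum-survivingPaths n) (Sum-survive n x)

      FirstHit : Pred A 0ℓ → ∀ {n} → Pred (Vec A (suc n)) 0ℓ
      FirstHit D xs = VecAll.All (∁ S) (init xs) × D (last xs)

      Sum-hittingPaths : ∀ D n x → Sum (FirstHit D) (pathWeight p x {suc n}) (hit D n x)
      Sum-hittingPaths D zero x = Sum-paths {E′ = λ _ → U}
        (λ { y [] (_ , d) → d , _ }) (λ { y [] d _ → VecAll.[] , d }) (λ _ → 1#) Sum-emptyPath
        (Sum-cong (λ y _ → sym (*-identityʳ _)) refl (Sum-hit-zero D x))
      Sum-hittingPaths D (suc n) x = Sum-paths {E′ = λ _ → FirstHit D}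
        (λ { y ys (a VecAll.∷ as , d) → a , as , d })
        (λ { y ys a (as , d) → a VecAll.∷ as , d })
        (hit D n) (Sum-hittingPaths D n) (Sum-hit D n x)

      hit+survive : ∀ n x → hit S n x + survive (suc n) x ≈ survive n x
      hit+survive zero x = Sum-unique
        (Sum-split _≟ᴬ_ S? (λ y _ → nonNegative x y)
          (Sum-⇔ {T = U ∩ S} (λ _ s → _ , s) (λ _ → proj₂) (Sum-hit-zero S x))
          (Sum-⇔ {T = U ∩ ∁ S} (λ _ s → _ , s) (λ _ → proj₂)
            (Sum-cong (λ y _ → *-identityʳ _) refl (Sum-survive 0 x))))
        (Sum-row x)
      hit+survive (suc n) x = Sum-unique
        (Sum-+ _≟ᴬ_ (λ y _ → nonNegative x y ⊗ 0≤hit S n y)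
          (λ y _ → nonNegative x y ⊗ 0≤survive (suc n) y) (Sum-hit S n x) (Sum-survive (suc n) x))
        (Sum-cong (λ y _ → trans (*-congˡ (sym (hit+survive n y))) (distribˡ _ _ _)) refl
          (Sum-survive n x))

      survive-antitone : ∀ n x → survive (suc n) x ≤ survive n x
      survive-antitone n x = difference (0≤hit S n x)
        (trans (+-comm _ _) (hit+survive n x))

      hits+survive : ∀ n x → sum (λ k → hit S k x) (downFrom n) + survive n x ≈ 1#
      hits+survive zero    x = +-identityˡ 1#
      hits+survive (suc n) x = begin
        hit S n x + sum (λ k → hit S k x) (downFrom n) + survive (suc n) x
          ≈⟨ solve 3 (λ a b c → a :+ b :+ c := b :+ (a :+ c)) refl _ _ _ ⟩
        sum (λ k → hit S k x) (downFrom n) + (hit S n x + survive (suc n) x)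
          ≈⟨ +-congˡ (hit+survive n x) ⟩
        sum (λ k → hit S k x) (downFrom n) + survive n x
          ≈⟨ hits+survive n x ⟩
        1# ∎

      hits≤1 : ∀ n x → sum (λ k → hit S k x) (downFrom n) ≤ 1#
      hits≤1 n x = difference (0≤survive n x) (hits+survive n x)

      -- Survival probabilities decrease, so each of the n summands is at least the next value.
      n*survive≤sum : ∀ n x → fromℕ n * survive n x ≤ sum (λ k → survive k x) (downFrom n)
      n*survive≤sum zero    x = ≤-reflexive (zeroˡ _)
      n*survive≤sum (suc n) x = ≤-trans (*-monoˡ-≤ (0≤fromℕ (suc n)) (survive-antitone n x))
        (difference (0≤- (n*survive≤sum n x))
          (solve 3 (λ n v s → (:1 :+ n) :* v :+ (s :- n :* v) := v :+ s) refl (fromℕ n) (survive n x) _))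

      module Supersolution (F : A → ℝ) (0≤F : ∀ x → 0# ≤ F x) {c : ℝ} (0<c : 0# < c)
               (mean-F : ∀ x → Bounded (∁ S) (λ y → p x y * F y) (F x - c)) where

        -- Foster's criterion: each step costs `F` at least `c` in mean, and `F` stays non-negative.
        -- The survival probabilities add up to the truncated mean hitting time.
        sum-survive≤F : ∀ n x → sum (λ k → c * survive k x) (downFrom n) ≤ F x
        sum-survive≤F zero    x = 0≤F x
        sum-survive≤F (suc n) x = ≤-trans (≤-reflexive (sum-downFrom-suc _ n)) (difference
          (0≤- (Sum-≤ (Sum-sum _≟ᴬ_ {F = λ k y → c * (p x y * survive k y)}
            (λ k y _ _ → proj₁ 0<c ⊗ (nonNegative x y ⊗ 0≤survive k y))
            (λ k _ → Sum-* (proj₁ 0<c) (Sum-survive k x)) {downFrom n} (All-U (downFrom n)))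
            (λ y _ → ≤-trans (≤-reflexive (factor y (downFrom n)))
              (*-monoˡ-≤ (nonNegative x y) (sum-survive≤F n y)))
            (mean-F x)))
          (solve 3 (λ c s F → c :* :1 :+ s :+ (F :- c :- s) := F) refl c _ (F x)))
          where
          factor : ∀ y ks → sum (λ k → c * (p x y * survive k y)) ks ≈ p x y * sum (λ k → c * survive k y) ks
          factor y []       = sym (zeroʳ _)
          factor y (k ∷ ks) = trans (+-congˡ (factor y ks))
            (solve 4 (λ c p v s → c :* (p :* v) :+ p :* s := p :* (c :* v :+ s)) refl c (p x y) _ _)

        -- A positive lower bound `d` would give n · c · d ≤ `F x` for every n, against the
        -- Archimedean property.
        survive→0 : ∀ x d → (∀ n → d ≤ survive n x) → d ≤ 0#
        survive→0 x d d≤ = ≤-stable λ d≰0 → let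
            0<cd = 0<* 0<c (≰⇒> d≰0) in
          fromℕ-unbounded ((c * d) ⁻¹ * F x) λ n → *-cancelˡ-≤ 0<cd (difference
            (0≤- (sum-survive≤F n x)
              ⊕ 0≤≈ (sym (sum-* c (λ k → survive k x) (downFrom n)))
              ⊕ proj₁ 0<c ⊗ (0≤- (n*survive≤sum n x) ⊕ 0≤fromℕ n ⊗ 0≤- (d≤ n))
              ⊕ 0≤* (F x) (*-⁻¹ 0<cd))
            (solve 8 (λ c d i n v s t F →
              c :* d :* n :+ (F :- t :+ (t :- c :* s)
                :+ c :* (s :- n :* v :+ n :* (v :- d)) :+ F :* (c :* d :* i :- :1))
                := c :* d :* (i :* F)) refl
              c d ((c * d) ⁻¹) (fromℕ n) (survive n x) (sum (λ k → survive k x) (downFrom n))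
              (sum (λ k → c * survive k x) (downFrom n)) (F x)))

        Sum-hits : ∀ x → Sum U (λ n → hit S n x) 1#
        Sum-hits x = record
          { upper = partialSums⇒Bounded (λ n → 0≤hit S n x) (λ n → hits≤1 n x)
          ; least = λ u b → difference
              (0≤- (survive→0 x (1# - u) λ n → difference
                (0≤- (b (downFrom n) (Unique.downFrom⁺ n) (All-U (downFrom n)))
                  ⊕ 0≤≈ (sym (hits+survive n x)))
                (solve 3 (λ u h v → :1 :- u :+ (u :- h :+ (h :+ v :- :1)) := v) refl u
                   (sum (λ k → hit S k x) (downFrom n)) _)))
              (solve 1 (λ u → :1 :+ (:0 :- (:1 :- u)) := u) refl u) }

      meanTime : A → ℝ
      meanTime x = ∑ U (λ n → fromℕ (suc n) * hit S n x)

      module MeanTime (F : A → ℝ) (0≤F : ∀ x → 0# ≤ F x)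
               (mean-F : ∀ x → Bounded (∁ S) (λ y → p x y * F y) (F x - 1#)) where
        open Supersolution F 0≤F 0<1 mean-F

        -- Write `fromℕ (suc k)` as `1# + fromℕ k`. The first part sums to at most `1#`, the amount
        -- that `F` loses in mean; the second, shifted by one step, is a mean of the inductive
        -- bound.
        sum-hits≤F : ∀ n x → sum (λ k → fromℕ (suc k) * hit S k x) (downFrom n) ≤ F x
        sum-hits≤F zero    x = 0≤F x
        sum-hits≤F (suc n) x = ≤-trans (≤-reflexive (begin
            sum (λ k → fromℕ (suc k) * hit S k x) (downFrom (suc n))
              ≈⟨ split (downFrom (suc n)) ⟩
            sum (λ k → hit S k x) (downFrom (suc n)) + sum (λ k → fromℕ k * hit S k x) (downFrom (suc n))
              ≈⟨ +-congˡ (trans (sum-downFrom-suc _ n) (trans (+-congʳ (zeroˡ _)) (+-identityˡ _))) ⟩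
            sum (λ k → hit S k x) (downFrom (suc n)) + sum (λ k → fromℕ (suc k) * hit S (suc k) x) (downFrom n) ∎))
          (difference
            (0≤- (hits≤1 (suc n) x) ⊕ 0≤- (Sum-≤
              (Sum-sum _≟ᴬ_ {F = λ k y → fromℕ (suc k) * (p x y * hit S k y)}
                (λ k y _ _ → 0≤fromℕ (suc k) ⊗ (nonNegative x y ⊗ 0≤hit S k y))
                (λ k _ → Sum-* (0≤fromℕ (suc k)) (Sum-hit S k x)) {downFrom n}
                (All-U (downFrom n)))
              (λ y _ → ≤-trans (≤-reflexive (factor y (downFrom n)))
                (*-monoˡ-≤ (nonNegative x y) (sum-hits≤F n y)))
              (mean-F x)))
            (solve 3 (λ a b F → a :+ b :+ (:1 :- a :+ (F :- :1 :- b)) := F) refl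
              (sum (λ k → hit S k x) (downFrom (suc n))) _ (F x)))
          where
          split : ∀ ks → sum (λ k → fromℕ (suc k) * hit S k x) ks
                       ≈ sum (λ k → hit S k x) ks + sum (λ k → fromℕ k * hit S k x) ks
          split []       = sym (+-identityˡ _)
          split (k ∷ ks) = trans (+-congˡ (split ks))
            (solve 4 (λ n h a b → (:1 :+ n) :* h :+ (a :+ b) := h :+ a :+ (n :* h :+ b)) refl
              (fromℕ k) (hit S k x) _ _)
          factor : ∀ y ks → sum (λ k → fromℕ (suc k) * (p x y * hit S k y)) ks
                          ≈ p x y * sum (λ k → fromℕ (suc k) * hit S k y) ks
          factor y []       = sym (zeroʳ _)
          factor y (k ∷ ks) = trans (+-congˡ (factor y ks))
            (solve 4 (λ c p v s → c :* (p :* v) :+ p :* s := p :* (c :* v :+ s)) refl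
              (fromℕ (suc k)) (p x y) _ _)

        bounded : ∀ x → Bounded U (λ n → fromℕ (suc n) * hit S n x) (F x)
        bounded x = partialSums⇒Bounded (λ n → 0≤fromℕ (suc n) ⊗ 0≤hit S n x) (λ n → sum-hits≤F n x)

        Sum-meanTime : ∀ x → Sum U (λ n → fromℕ (suc n) * hit S n x) (meanTime x)
        Sum-meanTime x = Sum-∑ (bounded x)

        meanTime≤F : ∀ x → meanTime x ≤ F x
        meanTime≤F x = ∑-≤ (bounded x)

        0≤meanTime : ∀ x → 0# ≤ meanTime x
        0≤meanTime x = 0≤Sum (Sum-meanTime x)

        -- The `1#` is the total mass of the hitting time distribution, so almost sure hitting
        -- enters here through `Sum-hits`.
        Sum-meanTime-step : ∀ x → Sum (∁ S) (λ y → p x y * meanTime y) (meanTime x - 1#)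
        Sum-meanTime-step x = Sum-cong (λ _ _ → refl) (trans
            (solve 2 (λ h r → r := :1 :+ (h :+ r) :- :1 :- h) refl (0# * hit S 0 x) r)
            (trans (+-congˡ (-‿cong (zeroˡ _)))
            (trans (solve 1 (λ h → h :- :0 := h) refl _)
            (+-congʳ (Sum-unique total (Sum-meanTime x))))))
          Sum-r
          where
          r = ∑ (∁ S) (λ y → p x y * meanTime y)
          Sum-r : Sum (∁ S) (λ y → p x y * meanTime y) r
          Sum-r = Sum-∑ (Bounded-mono (λ y _ → *-monoˡ-≤ (nonNegative x y) (meanTime≤F y)) (mean-F x))
          later : Sum U (λ n → fromℕ (suc n) * hit S (suc n) x) r
          later = Sum-swap _≟ᴬ_ ℕ._≟_ {F = λ y n → p x y * (fromℕ (suc n) * hit S n y)}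
            (λ y n _ _ → nonNegative x y ⊗ (0≤fromℕ (suc n) ⊗ 0≤hit S n y))
            (λ y _ → Sum-* (nonNegative x y) (Sum-meanTime y))
            (λ n _ → Sum-cong
              (λ y _ → solve 3 (λ a b c → a :* (b :* c) := b :* (a :* c)) refl (fromℕ (suc n)) (p x y) _)
              refl (Sum-* (0≤fromℕ (suc n)) (Sum-hit S n x)))
            Sum-r
          total : Sum U (λ n → fromℕ (suc n) * hit S n x) (1# + (0# * hit S 0 x + r))
          total = Sum-cong
            (λ n _ → solve 2 (λ n h → h :+ n :* h := (:1 :+ n) :* h) refl (fromℕ n) (hit S n x)) refl
            (Sum-+ ℕ._≟_ (λ n _ → 0≤hit S n x) (λ n _ → 0≤fromℕ n ⊗ 0≤hit S n x) (Sum-hits x)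
              (Sum-shift {f = λ n → fromℕ n * hit S n x} (λ n → 0≤fromℕ n ⊗ 0≤hit S n x) later))

        open Supersolution F 0≤F 0<1 mean-F public using (Sum-hits)

      -- `f` dominates survival at time 0, and each surviving step contributes one factor θ.
      survive-geometric : ∀ {θ} (f : A → ℝ) → 0# ≤ θ → (∀ x → 1# ≤ f x) →
                          (∀ x → Bounded (∁ S) (λ y → p x y * f y) (θ * f x)) →
                          ∀ n x → survive n x ≤ θ ^ n * f x
      survive-geometric f 0≤θ 1≤f mean-f zero    x = ≤-trans (1≤f x) (≤-reflexive (sym (*-identityˡ _)))
      survive-geometric {θ} f 0≤θ 1≤f mean-f (suc n) x = Sum-≤ (Sum-survive n x)
        (λ y _ → ≤-trans (*-monoˡ-≤ (nonNegative x y) (survive-geometric f 0≤θ 1≤f mean-f n y))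
          (≤-reflexive (solve 3 (λ p t f → p :* (t :* f) := t :* (p :* f)) refl (p x y) (θ ^ n) (f y))))
        (Bounded-≤ (≤-reflexive (solve 3 (λ t u f → u :* (t :* f) := t :* u :* f) refl θ (θ ^ n) (f x)))
          (Bounded-* (0≤^ n 0≤θ) (mean-f x)))

-- The chain watched on `B`.

module RestrictedChain (𝓡 : CompleteOrderedField) where
  open CompleteOrderedField 𝓡
  open Analysis 𝓡
  open Chains 𝓡
  open OrderedField 𝓡
  open UnorderedSums 𝓡
  open KilledChain 𝓡

  module Restricted {A : Set} (_≟ᴬ_ : DecidableEquality A) {p : Kernel A} (stochastic : IsStochastic p)
                    (V : A → ℝ) (b : ℝ) where
    open Restriction p V b public
    open Stochastic _≟ᴬ_ stochastic public

    inB : Pred A 0ℓ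
    inB x = V x ≤ b

    inB? : Decidable inB
    inB? x = V x ≤? b

    open Killed inB? public

    -- The membership proof stored in `B` is irrelevant; decidability of the order recovers a usable
    -- one.
    value∈B : (y : B) → inB (value y)
    value∈B (x , [ x∈B ]) = recompute (inB? x) x∈B

    _≟ᴮ_ : DecidableEquality B
    _≟ᴮ_ = Refinement._≟_ _≟ᴬ_

    Sum-B : ∀ {f : A → ℝ} {r} → Sum U (λ y → f (value y)) r → Sum inB f r
    Sum-B = Sum-reindex value value-injective (λ y _ → value∈B y) (λ x x∈B → (x , [ x∈B ]) , _ , ≡.refl)

    Sum-B′ : ∀ {f : A → ℝ} {r} → Sum inB f r → Sum U (λ (y : B) → f (value y)) r
    Sum-B′ {f} {r} s = Sum-cong (λ _ _ → refl) (Sum-unique (Sum-B t) s) t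
      where
      t : Sum U (λ y → f (value y)) (∑ U (λ y → f (value y)))
      t = Sum-∑ {u = r} λ ys ys! _ → ≤-trans (≤-reflexive (reflexive (≡.sym (sum-map f value ys))))
        (upper s _ (Unique.map⁺ value-injective ys!) (All.map⁺ (All.universal value∈B ys)))

    hitAt : B → ℕ → A → ℝ
    hitAt y = hit (_≡ value y)

    hitAt-zero : ∀ y x → hitAt y 0 x ≈ p x (value y)
    hitAt-zero y x = Sum-unique (Sum-hit-zero _ x)
      (Sum-point (value y) ≡.refl (λ _ → id) (nonNegative x (value y)))

    Sum-hitAt : ∀ n x → Sum U (λ y → hitAt y n x) (hit inB n x)
    Sum-hitAt zero x = Sum-cong (λ y _ → sym (hitAt-zero y x)) refl (Sum-B′ (Sum-hit-zero inB x))
    Sum-hitAt (suc n) x = Sum-swap _≟ᴬ_ _≟ᴮ_ {F = λ z y → p x z * hitAt y n z}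
      (λ z y _ _ → nonNegative x z ⊗ 0≤hit _ n z)
      (λ z _ → Sum-* (nonNegative x z) (Sum-hitAt n z))
      (λ y _ → Sum-hit _ n x) (Sum-hit inB n x)

    -- P(X_{S₁} = y) for the chain started anywhere, not just in B.
    entry : A → B → ℝ
    entry x y = ∑ U (λ n → hitAt y n x)

    entry-bounded : ∀ x y → Bounded U (λ n → hitAt y n x) 1#
    entry-bounded x y = partialSums⇒Bounded (λ n → 0≤hit _ n x) λ n → ≤-trans
      (sum-mono {S = U} (λ k _ → term≤Sum (Sum-hitAt k x) y _) (All-U (downFrom n))) (hits≤1 n x)

    Sum-entry : ∀ x y → Sum U (λ n → hitAt y n x) (entry x y)
    Sum-entry x y = Sum-∑ (entry-bounded x y)

    0≤entry : ∀ x y → 0# ≤ entry x y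
    0≤entry x y = 0≤Sum (Sum-entry x y)

    -- Entry at `y` happens either on the first step or after a first step that stays outside `B`.
    Sum-entry-step : ∀ x y → Sum (∁ inB) (λ z → p x z * entry z y) (entry x y - p x (value y))
    Sum-entry-step x y = Sum-cong (λ _ _ → refl)
      (trans (solve 2 (λ h r → r := h :+ r :- h) refl (hitAt y 0 x) r)
        (+-cong (Sum-unique (Sum-shift (λ n → 0≤hit _ n x) later) (Sum-entry x y))
                (-‿cong (hitAt-zero y x))))
      Sum-r
      where
      r = ∑ (∁ inB) (λ z → p x z * entry z y)
      Sum-r : Sum (∁ inB) (λ z → p x z * entry z y) r
      Sum-r = Sum-∑ (Bounded-mean (λ z → entry z y) x 0≤1 λ z _ → ∑-≤ (entry-bounded z y))
      later : Sum U (λ n → hitAt y (suc n) x) r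
      later = Sum-swap _≟ᴬ_ ℕ._≟_ {F = λ z n → p x z * hitAt y n z}
        (λ z n _ _ → nonNegative x z ⊗ 0≤hit _ n z)
        (λ z _ → Sum-* (nonNegative x z) (Sum-entry z y)) (λ n _ → Sum-hit _ n x) Sum-r

    pʸ≈entry : ∀ x y → pʸ x y ≈ entry (value x) y
    pʸ≈entry x y = Sum⇒∑ (Sum-cong (λ n _ → sym (Sum⇒∑ (Sum-⇔
        (λ { xs (as , ≡.refl) → (as , value∈B y) , ≡.refl })
        (λ { xs ((as , _) , eq) → as , eq })
        (Sum-hittingPaths (_≡ value y) n (value x))))) refl
      (Sum-entry (value x) y))

    -- With `g` the entry mean of `h` this is the harmonic extension of `h`: the mean of `h` at the
    -- first visit to `B`, time 0 included.
    extend : (B → ℝ) → (A → ℝ) → A → ℝ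
    extend h g z with inB? z
    ... | yes z∈B = h (z , [ z∈B ])
    ... | no  _   = g z

    extend-B : ∀ h g y → extend h g (value y) ≡ h y
    extend-B h g y with inB? (value y)
    ... | yes _   = ≡.refl
    ... | no y∉B = ⊥-elim (y∉B (value∈B y))

    extend-∁B : ∀ h g z → ¬ inB z → extend h g z ≡ g z
    extend-∁B h g z z∉B with inB? z
    ... | yes z∈B = ⊥-elim (z∉B z∈B)
    ... | no  _   = ≡.refl

    extend-elim : ∀ {h g} (Q : ℝ → Set) → (∀ y → Q (h y)) → (∀ z → Q (g z)) → ∀ z → Q (extend h g z)
    extend-elim Q Qh Qg z with inB? z
    ... | yes z∈B = Qh (z , [ z∈B ])
    ... | no  _   = Qg z

    module EntersB (Sum-hits : ∀ x → Sum U (λ n → hit inB n x) 1#) where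

      Sum-entry-row : ∀ x → Sum U (entry x) 1#
      Sum-entry-row x = Sum-swap ℕ._≟_ _≟ᴮ_ {F = λ n y → hitAt y n x}
        (λ n y _ _ → 0≤hit _ n x) (λ n _ → Sum-hitAt n x) (λ y _ → Sum-entry x y) (Sum-hits x)

      pʸ-stochastic : IsStochastic pʸ
      pʸ-stochastic = record
        { nonNegative = λ x y → ≤-trans (0≤entry (value x) y) (≤-reflexive (sym (pʸ≈entry x y)))
        ; rowSum = λ x → Sum⇒HasSum (Sum-cong (λ y _ → sym (pʸ≈entry x y)) refl
                                              (Sum-entry-row (value x))) }

      entryMean : (B → ℝ) → A → ℝ
      entryMean h x = ∑ U (λ y → entry x y * h y)

      module _ (h : B → ℝ) {c : ℝ} (0≤c : 0# ≤ c) (0≤h : ∀ y → 0# ≤ h y) (h≤c : ∀ y → h y ≤ c) where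

        entryMean-bounded : ∀ x → Bounded U (λ y → entry x y * h y) c
        entryMean-bounded x = Bounded-mono
          (λ y _ → ≤-trans (*-monoˡ-≤ (0≤entry x y) (h≤c y)) (≤-reflexive (*-comm (entry x y) c)))
          (Bounded-≤ (≤-reflexive (*-identityʳ c)) (Bounded-* 0≤c (upper (Sum-entry-row x))))

        Sum-entryMean : ∀ x → Sum U (λ y → entry x y * h y) (entryMean h x)
        Sum-entryMean x = Sum-∑ (entryMean-bounded x)

        entryMean≤ : ∀ x → entryMean h x ≤ c
        entryMean≤ x = ∑-≤ (entryMean-bounded x)

        0≤entryMean : ∀ x → 0# ≤ entryMean h x
        0≤entryMean x = 0≤Sum (Sum-entryMean x)

        -- The first visit to `B` at a time at least 1 is, seen from X₁, the first visit at a time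
        -- at least 0.
        firstStep : ∀ x → Sum U (λ z → p x z * extend h (entryMean h) z) (entryMean h x)
        firstStep x = Sum-cong (λ _ _ → refl) (Sum-unique whole (Sum-entryMean x))
          (Sum-split _≟ᴬ_ inB? (λ z _ → nonNegative x z ⊗ extend-elim (0# ≤_) 0≤h 0≤entryMean z)
            (Sum-⇔ {T = U ∩ inB} (λ _ s → _ , s) (λ _ → proj₂)
              (Sum-B (Sum-cong (λ y _ → *-congˡ (reflexive (≡.sym (extend-B h _ y)))) refl inside)))
            (Sum-⇔ {T = U ∩ ∁ inB} (λ _ s → _ , s) (λ _ → proj₂)
              (Sum-cong (λ z z∉B → *-congˡ (reflexive (≡.sym (extend-∁B h _ z z∉B)))) refl outside)))
          where
          r = ∑ U (λ (y : B) → p x (value y) * h y)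
          s = ∑ (∁ inB) (λ z → p x z * entryMean h z)
          p≤entry : ∀ y → p x (value y) ≤ entry x y
          p≤entry y = difference (0≤Sum (Sum-entry-step x y))
            (solve 2 (λ p q → p :+ (q :- p) := q) refl (p x (value y)) (entry x y))
          inside : Sum U (λ (y : B) → p x (value y) * h y) r
          inside = Sum-∑ (Bounded-mono (λ y _ → *-mono-≤ (nonNegative x _) (p≤entry y) (0≤h y) ≤-refl)
            (entryMean-bounded x))
          outside : Sum (∁ inB) (λ z → p x z * entryMean h z) s
          outside = Sum-∑ (Bounded-mean (entryMean h) x 0≤c λ z _ → entryMean≤ z)
          later : Sum U (λ y → h y * (entry x y - p x (value y))) s
          later = Sum-swap _≟ᴬ_ _≟ᴮ_ {F = λ z y → p x z * (entry z y * h y)}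
            (λ z y _ _ → nonNegative x z ⊗ (0≤entry z y ⊗ 0≤h y))
            (λ z _ → Sum-* (nonNegative x z) (Sum-entryMean z))
            (λ y _ → Sum-cong
              (λ z _ → solve 3 (λ h p q → h :* (p :* q) := p :* (q :* h)) refl (h y) (p x z) (entry z y)) refl
              (Sum-* (0≤h y) (Sum-entry-step x y)))
            outside
          whole : Sum U (λ y → entry x y * h y) (r + s)
          whole = Sum-cong
            (λ y _ → solve 3 (λ p h q → p :* h :+ h :* (q :- p) := q :* h) refl (p x (value y)) (h y) (entry x y))
            refl
            (Sum-+ _≟ᴮ_ (λ y _ → nonNegative x _ ⊗ 0≤h y) (λ y _ → 0≤h y ⊗ 0≤- (p≤entry y)) inside later)

      module Target (i : B) where
        module Y = Stochastic _≟ᴮ_ pʸ-stochastic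
        module Yⁱ = Y.Killed {S = _≡ i} (_≟ᴮ i)

        -- Moves the killing at `i` from the index set into the function, so that `firstStep`, which
        -- sums over all states, applies.
        avoid : (B → ℝ) → B → ℝ
        avoid h y = when (¬? (y ≟ᴮ i)) (h y)

        avoid≤ : ∀ h → (∀ y → 0# ≤ h y) → ∀ y → avoid h y ≤ h y
        avoid≤ h 0≤h y with ¬? (y ≟ᴮ i)
        ... | yes _ = ≤-refl
        ... | no  _ = 0≤h y

        Sum-avoid : ∀ (h : B → ℝ) {r} j → Sum (_≢ i) (λ y → pʸ j y * h y) r →
                    Sum U (λ y → entry (value j) y * avoid h y) r
        Sum-avoid h j s = Sum-cong (λ y _ → pull-out y) refl
          (Sum-when (λ y → ¬? (y ≟ᴮ i)) (Sum-⇔ {T = U ∩ (_≢ i)} (λ _ s → _ , s) (λ _ → proj₂)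
            (Sum-cong (λ y _ → *-congʳ (pʸ≈entry j y)) refl s)))
          where
          pull-out : ∀ y → when (¬? (y ≟ᴮ i)) (entry (value j) y * h y) ≈ entry (value j) y * avoid h y
          pull-out y with ¬? (y ≟ᴮ i)
          ... | yes _ = refl
          ... | no  _ = sym (zeroʳ _)

        entryMean-avoid : ∀ (h : B → ℝ) {r} j → Sum (_≢ i) (λ y → pʸ j y * h y) r → entryMean (avoid h) (value j) ≈ r
        entryMean-avoid h j s = Sum⇒∑ (Sum-avoid h j s)

-- Irreducibility and bounded mean return times on `B`.

module IrreducibleChain (𝓡 : CompleteOrderedField) where
  open CompleteOrderedField 𝓡
  open Analysis 𝓡
  open Chains 𝓡
  open OrderedField 𝓡
  open UnorderedSums 𝓡
  open KilledChain 𝓡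
  open RestrictedChain 𝓡
  open import Relation.Binary.Reasoning.Setoid setoid

  module Irreducible {A : Set} (_≟ᴬ_ : DecidableEquality A) {p : Kernel A} (stochastic : IsStochastic p)
    (irreducible : IsIrreducible p) (V : A → ℝ) (b : ℝ) (finite : Restriction.Finite-B p V b) where
    open Restricted _≟ᴬ_ stochastic V b public

    module ReturnTime (Sum-hits : ∀ x → Sum U (λ n → hit inB n x) 1#) (i : B) where
      open EntersB Sum-hits public
      open Target i public

      private
        -- The probability that `Y` avoids `i` at times 0 to n; `survive` alone ignores time 0.
        v : ℕ → B → ℝ
        v n = avoid (Yⁱ.survive n)

      0≤v : ∀ n y → 0# ≤ v n y
      0≤v n y = 0≤when (¬? (y ≟ᴮ i)) (Yⁱ.0≤survive n y)

      v≤survive : ∀ n y → v n y ≤ Yⁱ.survive n y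
      v≤survive n = avoid≤ (Yⁱ.survive n) (Yⁱ.0≤survive n)

      v≤1 : ∀ n y → v n y ≤ 1#
      v≤1 n y = ≤-trans (v≤survive n y) (Yⁱ.survive≤1 n y)

      -- u n x is the probability that the first n + 1 visits to B, counted
      -- from time 0, avoid i.
      u : ℕ → A → ℝ
      u n = extend (v n) (entryMean (v n))

      -- By `firstStep` the entry mean averages `u n` over one step, so the shortfall at `z` is
      -- missing from the total mass, weighted with `p x z`.
      entryMean<1 : ∀ n x z → 0# < p x z → 0# < 1# - u n z → 0# < 1# - entryMean (v n) x
      entryMean<1 n x z 0<pxz 0<1-uz = pos-≤ (0<* 0<pxz 0<1-uz)
        (difference (0≤- (Sum-≤ loss below (upper (Sum-row x))))
          (solve 2 (λ g d → d :+ (:1 :- (g :+ d)) := :1 :- g) refl (entryMean (v n) x) (p x z * (1# - u n z))))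
        where
        d : A → ℝ
        d y = p x y * (1# - u n y)
        0≤1-u : ∀ y → 0# ≤ 1# - u n y
        0≤1-u = extend-elim (λ r → 0# ≤ 1# - r) (λ y → 0≤- (v≤1 n y))
          (λ y → 0≤- (entryMean≤ (v n) 0≤1 (0≤v n) (v≤1 n) y))
        loss : Sum U (λ y → p x y * u n y + when (y ≟ᴬ z) (d y)) (entryMean (v n) x + d z)
        loss = Sum-+ _≟ᴬ_
          (λ y _ → nonNegative x y ⊗ extend-elim (0# ≤_) (0≤v n) (0≤entryMean (v n) 0≤1 (0≤v n) (v≤1 n)) y)
          (λ y _ → 0≤when (y ≟ᴬ z) (nonNegative x y ⊗ 0≤1-u y))
          (firstStep (v n) 0≤1 (0≤v n) (v≤1 n) x)
          (Sum-when (_≟ᴬ z) (Sum-point z (_ , ≡.refl) (λ _ → proj₂) (nonNegative x z ⊗ 0≤1-u z)))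
        below : ∀ y → U y → p x y * u n y + when (y ≟ᴬ z) (d y) ≤ p x y
        below y _ with y ≟ᴬ z
        ... | yes _ = ≤-reflexive (solve 2 (λ p u → p :* u :+ p :* (:1 :- u) := p) refl (p x y) (u n y))
        ... | no  _ = difference (nonNegative x y ⊗ 0≤1-u y)
          (solve 2 (λ p u → p :* u :+ :0 :+ p :* (:1 :- u) := p) refl (p x y) (u n y))

      -- Works backwards from the end of the path, where `u 0` vanishes. The index grows by one at
      -- each earlier state of the path that lies in `B`, since one more visit is counted there.
      path⇒u<1 : ∀ {n} x (xs : Vec A n) → 0# < pathWeight p x xs → last (x ∷ xs) ≡ value i →
                 ∃ λ n → 0# < 1# - u n x
      path⇒u<1 x [] _ ≡.refl = 0 , pos-≤ 0<1 (≤-reflexive (begin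
          1#            ≈⟨ solve 0 (:1 := :1 :- :0) refl ⟩
          1# - 0#       ≈⟨ +-congˡ (-‿cong (sym (trans (reflexive (extend-B (v 0) _ i)) (when-no (¬? (i ≟ᴮ i)) _ (λ ¬i → ¬i ≡.refl))))) ⟩
          1# - u 0 x    ∎))
      path⇒u<1 x (z ∷ xs) 0<w eq with path⇒u<1 z xs (0<*ʳ (0≤pathWeight z xs) 0<w) eq
      ... | n , 0<1-uz = lift (inB? x)
        where
        g<1 : 0# < 1# - entryMean (v n) x
        g<1 = entryMean<1 n x z (0<*ˡ (nonNegative x z) 0<w) 0<1-uz
        lift : Dec (inB x) → ∃ λ n → 0# < 1# - u n x
        lift (no x∉B) = n , pos-≤ g<1 (≤-reflexive (+-congˡ (-‿cong (reflexive (≡.sym (extend-∁B (v n) _ x x∉B))))))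
        lift (yes x∈B) = suc n , pos-≤ g<1 (difference
          (0≤- (v≤survive (suc n) y) ⊕ 0≤≈ (reflexive (extend-B (v (suc n)) _ y))
            ⊕ 0≤≈ (sym (entryMean-avoid (Yⁱ.survive n) y (Yⁱ.Sum-survive n y))))
          (solve 4 (λ g v s u → :1 :- g :+ (s :- v :+ (v :- u) :+ (g :- s)) := :1 :- u) refl
            (entryMean (v n) x) (v (suc n) y) (Yⁱ.survive (suc n) y) (u (suc n) x)))
          where y = x , [ x∈B ]

      -- A positive supremum of path sums does not exhibit a path of positive weight; but if no path
      -- led to the conclusion, all weights, and with them the supremum, would be at most zero.
      eventually-v<1 : ∀ j → ¬ ¬ ∃ λ n → 0# < 1# - v n j
      eventually-v<1 j never with irreducible (value j) (value i)
      ... | n , 0<ℙ = <⇒≱ 0<ℙ (∑-≤ (Bounded-mono weight≤0 (upper Sum-0)))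
        where
        weight≤0 : ∀ xs → last (value j ∷ xs) ≡ value i → pathWeight p (value j) xs ≤ 0#
        weight≤0 xs ends = ≤-stable λ w≰0 →
          let m , 0<1-u = path⇒u<1 (value j) xs (≰⇒> w≰0) ends
          in never (m , pos-≤ 0<1-u (≤-reflexive (+-congˡ (-‿cong (reflexive (extend-B (v m) _ j))))))

      v-antitone : ∀ m n y → v (m ℕ.+ n) y ≤ v n y
      v-antitone m n y with ¬? (y ≟ᴮ i)
      ... | no  _ = ≤-refl
      ... | yes _ = survive-antitone+ m
        where
        survive-antitone+ : ∀ m → Yⁱ.survive (m ℕ.+ n) y ≤ Yⁱ.survive n y
        survive-antitone+ zero    = ≤-refl
        survive-antitone+ (suc m) = ≤-trans (Yⁱ.survive-antitone (m ℕ.+ n) y) (survive-antitone+ m)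

      -- Horizons are added, which is harmless because `v` is antitone in time, and the smaller gap
      -- is kept. Finiteness of the list allows the double negations to be chained.
      v-uniform : ∀ ys → ¬ ¬ ∃ λ n → ∃ λ ε → 0# < ε × All (λ y → v n y ≤ 1# - ε) ys
      v-uniform []       k = k (0 , 1# , 0<1 , [])
      v-uniform (y ∷ ys) k = eventually-v<1 y λ { (m , 0<1-v) → v-uniform ys λ { (n , ε , 0<ε , v≤) →
        let
          headBound : ∀ {δ} → δ ≤ 1# - v m y → v (n ℕ.+ m) y ≤ 1# - δ
          headBound {δ} δ≤ = difference (0≤- (v-antitone n m y) ⊕ 0≤- δ≤)
            (solve 3 (λ a c d → a :+ (c :- a :+ (:1 :- c :- d)) := :1 :- d) refl _ (v m y) δ)
          tailBound : ∀ {δ z} → δ ≤ ε → v n z ≤ 1# - ε → v (n ℕ.+ m) z ≤ 1# - δ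
          tailBound {δ} {z} δ≤ε v≤ = difference
            (0≤- (≡.subst (λ l → v l z ≤ v n z) (ℕ.+-comm m n) (v-antitone m n z)) ⊕ 0≤- v≤ ⊕ 0≤- δ≤ε)
            (solve 4 (λ a c e d → a :+ (c :- a :+ (:1 :- e :- c) :+ (e :- d)) := :1 :- d) refl _ (v n z) ε δ)
        in [ (λ 1-v≤ε → k (n ℕ.+ m , 1# - v m y , 0<1-v ,
               headBound ≤-refl ∷ All.map (λ {z} → tailBound {z = z} 1-v≤ε) v≤))
           , (λ ε≤1-v → k (n ℕ.+ m , ε , 0<ε ,
               headBound ε≤1-v ∷ All.map (λ {z} → tailBound {z = z} ≤-refl) v≤))
           ]′ (≤-total (1# - v m y) ε) } }

      -- If the target is hit within n + 1 steps with probability at least ε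
      -- from everywhere, then (1/ε) ∑_{k ≤ n} P(T > k) is a supersolution.
      supersolution : ¬ ¬ ∃ λ (F : B → ℝ) → ∃ λ c → (∀ y → 0# ≤ F y) × (∀ y → F y ≤ c) ×
                      (∀ j → Bounded (_≢ i) (λ y → pʸ j y * F y) (F j - 1#))
      supersolution k = v-uniform (proj₁ finite) λ { (n , ε , 0<ε , v≤) →
        let
          v≤1-ε : ∀ y → v n y ≤ 1# - ε
          v≤1-ε y = All.lookup v≤ (proj₂ finite y)
          survive≤1-ε : ∀ j → Yⁱ.survive (suc n) j ≤ 1# - ε
          survive≤1-ε j = Sum-≤ (Yⁱ.Sum-survive n j)
            (λ y y≢i → *-monoˡ-≤ (Y.nonNegative j y)
              (≤-trans (≤-reflexive (sym (when-yes (¬? (y ≟ᴮ i)) _ y≢i))) (v≤1-ε y)))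
            (Y.Bounded-mean (λ _ → 1# - ε) j (≤-trans (0≤v n i) (v≤1-ε i)) (λ _ _ → ≤-refl))
          ks = downFrom (suc n)
          total : B → ℝ
          total j = sum (λ k → Yⁱ.survive k j) ks
          0≤total : ∀ j → 0# ≤ total j
          0≤total j = 0≤sum (λ k _ → Yⁱ.0≤survive k j) (All-U ks)
          factor : ∀ j y ks → sum (λ k → ε ⁻¹ * (pʸ j y * Yⁱ.survive k y)) ks
                            ≈ pʸ j y * (ε ⁻¹ * sum (λ k → Yⁱ.survive k y) ks)
          factor j y ks = trans (sum-* (ε ⁻¹) (λ k → pʸ j y * Yⁱ.survive k y) ks) (trans (*-congˡ (sum-* (pʸ j y) (λ k → Yⁱ.survive k y) ks))
            (solve 3 (λ e p s → e :* (p :* s) := p :* (e :* s)) refl (ε ⁻¹) (pʸ j y) _))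
          later : B → ℝ
          later j = sum (λ k → Yⁱ.survive (suc k) j) ks
        in k ((λ j → ε ⁻¹ * total j) , ε ⁻¹ * sum (λ _ → 1#) ks ,
          (λ j → proj₁ (0<*⁻¹ 0<ε) ⊗ 0≤total j) ,
          (λ j → *-monoˡ-≤ (proj₁ (0<*⁻¹ 0<ε)) (sum-mono (λ k _ → Yⁱ.survive≤1 k j) (All-U ks))) ,
          -- One step turns the sum over k ≤ n into the shifted one: the term `1#` is replaced by
          -- `survive (suc n)`, at most `1# - ε`. The sum drops by at least `ε`, hence `ε ⁻¹` times
          -- it by at least `1#`.
          (λ j → Bounded-≤ (difference
              (proj₁ (0<*⁻¹ 0<ε) ⊗ (0≤- (survive≤1-ε j) ⊕ 0≤≈ (sym (sum-downFrom-suc (λ k → Yⁱ.survive k j) (suc n))))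
                ⊕ 0≤* 1# (*-⁻¹ 0<ε) ⊕ 0≤≈ (sum-* (ε ⁻¹) (λ k → Yⁱ.survive (suc k) j) ks))
              (solve 6 (λ e i s t l l′ → l′ :+ (i :* (:1 :- e :- s :+ ((s :+ t) :- (:1 :+ l)))
                  :+ :1 :* (e :* i :- :1) :+ (i :* l :- l′)) := i :* t :- :1) refl
                ε (ε ⁻¹) (Yⁱ.survive (suc n) j) (total j) (later j) _))
            (Bounded-mono (λ y _ → ≤-reflexive (sym (factor j y ks)))
              (upper (Sum-sum _≟ᴮ_ {F = λ k y → ε ⁻¹ * (pʸ j y * Yⁱ.survive k y)}
                (λ k y _ _ → proj₁ (0<*⁻¹ 0<ε) ⊗ (Y.nonNegative j y ⊗ Yⁱ.0≤survive k y))
                (λ k _ → Sum-* (proj₁ (0<*⁻¹ 0<ε)) (Yⁱ.Sum-survive k j)) (All-U ks)))))) }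

-- The exponential series and its elementary inequalities.

module Exponential (𝓡 : CompleteOrderedField) where
  open CompleteOrderedField 𝓡
  open Analysis 𝓡
  open OrderedField 𝓡
  open UnorderedSums 𝓡
  open KilledChain 𝓡 using (sum-downFrom-suc)
  open Mult semiring using (×1-homo-*)
  open import Relation.Binary.Reasoning.Setoid setoid

  half : ℝ
  half = (1# + 1#) ⁻¹

  half+half : half + half ≈ 1#
  half+half = trans (solve 1 (λ h → h :+ h := (:1 :+ :1) :* h) refl half)
    (*-⁻¹ (pos-≤ 0<1 (difference 0≤1 refl)))

  0≤half : 0# ≤ half
  0≤half = proj₁ (0<*⁻¹ (pos-≤ 0<1 (difference 0≤1 refl)))

  ^-cong : ∀ {x y} n → x ≈ y → x ^ n ≈ y ^ n
  ^-cong zero    x≈y = refl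
  ^-cong (suc n) x≈y = *-cong x≈y (^-cong n x≈y)

  coefficient : ℕ → ℝ
  coefficient n = fromℕ (n !) ⁻¹

  term : ℝ → ℕ → ℝ
  term x n = x ^ n / fromℕ (n !)

  0<fromℕ! : ∀ n → 0# < fromℕ (n !)
  0<fromℕ! n with n ! | ℕ._!≢0 n
  ... | suc m | _ = 0<fromℕ-suc m

  0≤coefficient : ∀ n → 0# ≤ coefficient n
  0≤coefficient n = proj₁ (0<*⁻¹ (0<fromℕ! n))

  0≤term : ∀ {x} → 0# ≤ x → ∀ n → 0# ≤ term x n
  0≤term 0≤x n = 0≤^ n 0≤x ⊗ 0≤coefficient n

  term-zero : ∀ x → term x 0 ≈ 1#
  term-zero x = trans (solve 1 (λ a → :1 :* a := (:1 :+ :0) :* a) refl (coefficient 0)) (*-⁻¹ (0<fromℕ! 0))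

  coefficient-suc : ∀ n → fromℕ (suc n) * coefficient (suc n) ≈ coefficient n
  coefficient-suc n = *-⁻¹-unique (0<fromℕ! n) (begin
    fromℕ (n !) * (fromℕ (suc n) * coefficient (suc n))
      ≈⟨ solve 3 (λ a b c → a :* (b :* c) := b :* a :* c) refl _ _ _ ⟩
    fromℕ (suc n) * fromℕ (n !) * coefficient (suc n)
      ≈⟨ *-congʳ (sym (×1-homo-* (suc n) (n !))) ⟩
    fromℕ (suc n !) * coefficient (suc n)
      ≈⟨ *-⁻¹ (0<fromℕ! (suc n)) ⟩
    1# ∎)

  -- A mean value bound with the derivative taken at the far end; `^-tangent-≤` takes it at the near
  -- end. Both go by induction on the exponent, without binomial coefficients.
  ^-secant-≤ : ∀ {x t} → 0# ≤ x → 0# ≤ t → ∀ n →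
               (x + t) ^ suc n ≤ x ^ suc n + fromℕ (suc n) * (t * (x + t) ^ n)
  ^-secant-≤ {x} {t} 0≤x 0≤t zero = ≤-reflexive
    (solve 2 (λ x t → (x :+ t) :* :1 := x :* :1 :+ (:1 :+ :0) :* (t :* :1)) refl x t)
  ^-secant-≤ {x} {t} 0≤x 0≤t (suc n) = difference
    ((0≤x ⊕ 0≤t) ⊗ 0≤- (^-secant-≤ 0≤x 0≤t n)
      ⊕ 0≤t ⊗ 0≤- (^-mono-≤ (suc n) 0≤x (difference 0≤t refl)))
    (solve 5 (λ x t a b n →
        (x :+ t) :* ((x :+ t) :* a) :+ ((x :+ t) :* (x :* b :+ (:1 :+ n) :* (t :* a) :- (x :+ t) :* a)
          :+ t :* ((x :+ t) :* a :- x :* b))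
        := x :* (x :* b) :+ (:1 :+ (:1 :+ n)) :* (t :* ((x :+ t) :* a)))
      refl x t ((x + t) ^ n) (x ^ n) (fromℕ n))

  ^-tangent-≤ : ∀ {x t} → 0# ≤ x → 0# ≤ t → ∀ n →
                x ^ suc n + fromℕ (suc n) * (t * x ^ n) ≤ (x + t) ^ suc n
  ^-tangent-≤ {x} {t} 0≤x 0≤t zero = ≤-reflexive
    (solve 2 (λ x t → x :* :1 :+ (:1 :+ :0) :* (t :* :1) := (x :+ t) :* :1) refl x t)
  ^-tangent-≤ {x} {t} 0≤x 0≤t (suc n) = difference
    ((0≤x ⊕ 0≤t) ⊗ 0≤- (^-tangent-≤ 0≤x 0≤t n) ⊕ 0≤fromℕ (suc n) ⊗ (0≤t ⊗ (0≤t ⊗ 0≤^ n 0≤x)))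
    (solve 5 (λ x t a b n →
        x :* (x :* b) :+ (:1 :+ (:1 :+ n)) :* (t :* (x :* b))
          :+ ((x :+ t) :* ((x :+ t) :* a :- (x :* b :+ (:1 :+ n) :* (t :* b))) :+ (:1 :+ n) :* (t :* (t :* b)))
        := (x :+ t) :* ((x :+ t) :* a))
      refl x t ((x + t) ^ n) (x ^ n) (fromℕ n))

  -- The derivative of a term of the exponential series is the preceding term; the leading zero
  -- aligns the two series.
  shifted : (ℕ → ℝ) → ℕ → ℝ
  shifted f zero    = 0#
  shifted f (suc n) = f n

  0≤shifted : ∀ {f} → (∀ n → 0# ≤ f n) → ∀ n → 0# ≤ shifted f n
  0≤shifted 0≤f zero    = ≤-refl
  0≤shifted 0≤f (suc n) = 0≤f n

  term-secant-≤ : ∀ {x t} → 0# ≤ x → 0# ≤ t → ∀ n →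
                  term (x + t) n ≤ term x n + shifted (λ k → t * term (x + t) k) n
  term-secant-≤ {x} {t} 0≤x 0≤t zero    = ≤-reflexive (sym (+-identityʳ _))
  term-secant-≤ {x} {t} 0≤x 0≤t (suc n) = ≤-trans (difference
    (0≤- (^-secant-≤ 0≤x 0≤t n) ⊗ 0≤coefficient (suc n) ⊕ 0≤* (t * (x + t) ^ n) (sym (coefficient-suc n)))
    (solve 6 (λ a b m c d t′ → a :* c :+ ((b :+ m :* t′ :- a) :* c :+ t′ :* (d :- m :* c))
        := b :* c :+ t′ :* d) refl
      ((x + t) ^ suc n) (x ^ suc n) (fromℕ (suc n)) (coefficient (suc n)) (coefficient n) (t * (x + t) ^ n)))
    (≤-reflexive (+-congˡ (*-assoc t _ _)))

  term-tangent-≤ : ∀ {x t} → 0# ≤ x → 0# ≤ t → ∀ n →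
                   term x n + shifted (λ k → t * term x k) n ≤ term (x + t) n
  term-tangent-≤ {x} {t} 0≤x 0≤t zero    = ≤-reflexive (+-identityʳ _)
  term-tangent-≤ {x} {t} 0≤x 0≤t (suc n) = difference
    (0≤- (^-tangent-≤ 0≤x 0≤t n) ⊗ 0≤coefficient (suc n) ⊕ 0≤* (t * x ^ n) (coefficient-suc n))
    (solve 7 (λ a b m c d t p → b :* c :+ t :* (p :* d) :+ ((a :- (b :+ m :* (t :* p))) :* c :+ t :* p :* (m :* c :- d))
        := a :* c) refl
      ((x + t) ^ suc n) (x ^ suc n) (fromℕ (suc n)) (coefficient (suc n)) (coefficient n) t (x ^ n))

  P : ℕ → ℝ → ℝ
  P n x = sum (term x) (downFrom n)

  -- Stated for Taylor polynomials because convergence of the series is itself deduced from it.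
  P-secant : ∀ {x t} → 0# ≤ x → 0# ≤ t → ∀ n → P n (x + t) ≤ P n x + t * P n (x + t)
  P-secant {x} {t} 0≤x 0≤t zero    = ≤-reflexive (solve 1 (λ t → :0 := :0 :+ t :* :0) refl t)
  P-secant {x} {t} 0≤x 0≤t (suc n) = ≤-trans
    (sum-mono {S = U} (λ k _ → term-secant-≤ 0≤x 0≤t k) (All-U (downFrom (suc n))))
    (difference (0≤t ⊗ 0≤term (0≤x ⊕ 0≤t) n
        ⊕ 0≤≈ (sum-+ (term x) (shifted λ k → t * term (x + t) k) (downFrom (suc n)))
        ⊕ 0≤≈ (sum-downFrom-suc (shifted λ k → t * term (x + t) k) n)
        ⊕ 0≤≈ (sum-* t (term (x + t)) (downFrom n)))
      (solve 7 (λ a p s s′ t T q → a :+ (t :* T :+ ((p :+ s) :- a) :+ (:0 :+ s′ :- s) :+ (t :* q :- s′))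
        := p :+ t :* (T :+ q)) refl
        (sum (λ k → term x k + shifted (λ k → t * term (x + t) k) k) (downFrom (suc n)))
        (P (suc n) x)
        (sum (shifted λ k → t * term (x + t) k) (downFrom (suc n)))
        (sum (λ k → t * term (x + t) k) (downFrom n)) t (term (x + t) n) (P n (x + t))))

  P-0 : ∀ n → P n 0# ≤ 1#
  P-0 zero    = 0≤1
  P-0 (suc n) = ≤-reflexive (trans (sum-downFrom-suc (term 0#) n)
    (trans (+-cong (term-zero 0#) (later (downFrom n))) (+-identityʳ 1#)))
    where
    later : ∀ ks → sum (term 0# ∘ suc) ks ≈ 0#
    later []       = refl
    later (k ∷ ks) = trans (+-cong (trans (*-congʳ (zeroˡ _)) (zeroˡ _)) (later ks)) (+-identityˡ 0#)

  -- By `P-secant` a step of one half at most doubles a Taylor polynomial, so its value at a natural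
  -- number n is at most 4 to the power n, whatever the degree. A natural number above `x` is
  -- available only up to double negation.
  term-bounded : ∀ {x} → 0# ≤ x → ¬ ¬ ∃ λ u → Bounded U (term x) u
  term-bounded {x} 0≤x k = fromℕ-unbounded x λ n → ≤-stable λ n≰x →
    k (fromℕ 4 ^ n , partialSums⇒Bounded (0≤term 0≤x) λ m →
      ≤-trans (P-mono m 0≤x (≰⇒≥ n≰x)) (P-fromℕ n m))
    where
    P-mono : ∀ m {x y} → 0# ≤ x → x ≤ y → P m x ≤ P m y
    P-mono m 0≤x x≤y = sum-mono {S = U}
      (λ n _ → *-mono-≤ (0≤^ n 0≤x) (^-mono-≤ n 0≤x x≤y) (0≤coefficient n) ≤-refl) (All-U (downFrom m))
    doubles : ∀ m {x} → 0# ≤ x → P m (x + half) ≤ (1# + 1#) * P m x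
    doubles m {x} 0≤x = difference
      (0≤2 ⊗ 0≤- (P-secant 0≤x 0≤half m) ⊕ 0≤* (P m (x + half)) (sym half+half))
      (solve 3 (λ a b h → b :+ ((:1 :+ :1) :* (a :+ h :* b :- b) :+ b :* (:1 :- (h :+ h)))
        := (:1 :+ :1) :* a) refl (P m x) (P m (x + half)) half)
    P-cong : ∀ m {x y} → x ≈ y → P m x ≤ P m y
    P-cong m x≈y = sum-mono {S = U} (λ n _ → ≤-reflexive (*-congʳ (^-cong n x≈y))) (All-U (downFrom m))
    P-fromℕ : ∀ n m → P m (fromℕ n) ≤ fromℕ 4 ^ n
    P-fromℕ zero    m = P-0 m
    P-fromℕ (suc n) m = ≤-trans
      (P-cong m (trans (+-congʳ (sym half+half)) (solve 2 (λ h n → h :+ h :+ n := n :+ h :+ h) refl half (fromℕ n))))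
      (≤-trans (doubles m (0≤fromℕ n ⊕ 0≤half))
      (≤-trans (*-monoˡ-≤ 0≤2 (doubles m (0≤fromℕ n)))
      (≤-trans (*-monoˡ-≤ 0≤2 (*-monoˡ-≤ 0≤2 (P-fromℕ n m)))
        (≤-reflexive (solve 1 (λ a → (:1 :+ :1) :* ((:1 :+ :1) :* a) := :4 :* a) refl (fromℕ 4 ^ n))))))

  Sum-expSeries : ∀ {x} → 0# ≤ x → Sum U (term x) (expSeries x)
  Sum-expSeries 0≤x = record
    { upper = λ xs xs! Uxs → ≤-stable λ ≰ → term-bounded 0≤x λ { (u , b) → ≰ (upper (Sum-∑ b) xs xs! Uxs) }
    ; least = λ u b → ∑-≤ b }

  expSeries-cong : ∀ {x y} → 0# ≤ x → x ≈ y → expSeries x ≈ expSeries y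
  expSeries-cong 0≤x x≈y = sym (Sum⇒∑ (Sum-cong (λ n _ → *-congʳ (^-cong n x≈y)) refl (Sum-expSeries 0≤x)))

  1≤expSeries : ∀ {x} → 0# ≤ x → 1# ≤ expSeries x
  1≤expSeries {x} 0≤x = ≤-trans (≤-reflexive (sym (term-zero x))) (term≤Sum (Sum-expSeries 0≤x) 0 _)

  expSeries-0 : expSeries 0# ≤ 1#
  expSeries-0 = ∑-≤ (partialSums⇒Bounded (0≤term ≤-refl) P-0)

  private
    x+[y-x] : ∀ {x y} → x + (y - x) ≈ y
    x+[y-x] {x} {y} = solve 2 (λ x y → x :+ (y :- x) := y) refl x y

  expSeries-secant : ∀ {x y} → 0# ≤ x → x ≤ y → expSeries y ≤ expSeries x + (y - x) * expSeries y
  expSeries-secant {x} {y} 0≤x x≤y = ≤-trans (≤-reflexive (expSeries-cong 0≤y (sym x+[y-x])))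
    (≤-trans (least (Sum-expSeries 0≤y′) _ (partialSums⇒Bounded (0≤term 0≤y′) λ n →
        ≤-trans (P-secant 0≤x (0≤- x≤y) n) (+-mono-≤ (partialSum≤Sum (Sum-expSeries 0≤x) n)
          (*-monoˡ-≤ (0≤- x≤y) (partialSum≤Sum (Sum-expSeries 0≤y′) n)))))
      (≤-reflexive (+-congˡ (*-congˡ (sym (expSeries-cong 0≤y (sym x+[y-x])))))))
    where
    0≤y = ≤-trans 0≤x x≤y
    0≤y′ = 0≤x ⊕ 0≤- x≤y

  expSeries-tangent : ∀ {x y} → 0# ≤ x → x ≤ y → (1# + (y - x)) * expSeries x ≤ expSeries y
  expSeries-tangent {x} {y} 0≤x x≤y = ≤-trans
    (≤-reflexive (solve 2 (λ t e → (:1 :+ t) :* e := e :+ (:0 :+ t :* e)) refl (y - x) (expSeries x)))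
    (≤-trans (Sum-≤ (Sum-+ ℕ._≟_ (λ n _ → 0≤term 0≤x n) (λ n _ → 0≤shifted 0≤t*term n) (Sum-expSeries 0≤x)
        (Sum-shift (0≤shifted 0≤t*term) (Sum-* (0≤- x≤y) (Sum-expSeries 0≤x))))
      (λ n _ → term-tangent-≤ 0≤x (0≤- x≤y) n) (upper (Sum-expSeries (0≤x ⊕ 0≤- x≤y))))
    (≤-reflexive (expSeries-cong (0≤x ⊕ 0≤- x≤y) x+[y-x])))
    where
    0≤t*term : ∀ n → 0# ≤ (y - x) * term x n
    0≤t*term n = 0≤- x≤y ⊗ 0≤term 0≤x n

  expSeries-mono : ∀ {x y} → 0# ≤ x → x ≤ y → expSeries x ≤ expSeries y
  expSeries-mono {x} {y} 0≤x x≤y = ≤-trans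
    (difference (0≤- x≤y ⊗ ≤-trans 0≤1 (1≤expSeries 0≤x))
      (solve 2 (λ t e → e :+ t :* e := (:1 :+ t) :* e) refl (y - x) (expSeries x)))
    (expSeries-tangent 0≤x x≤y)

  1+x≤expSeries : ∀ {x} → 0# ≤ x → 1# + x ≤ expSeries x
  1+x≤expSeries {x} 0≤x = ≤-trans
    (difference ((0≤1 ⊕ 0≤x) ⊗ 0≤- (1≤expSeries ≤-refl))
      (solve 2 (λ x e → :1 :+ x :+ (:1 :+ x) :* (e :- :1) := (:1 :+ (x :- :0)) :* e) refl x (expSeries 0#)))
    (expSeries-tangent ≤-refl 0≤x)

  exp≡expSeries : ∀ {x} → 0# ≤ x → exp x ≡ expSeries x
  exp≡expSeries {x} 0≤x with 0# ≤? x
  ... | yes _   = ≡.refl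
  ... | no  0≰x = ⊥-elim (0≰x 0≤x)

  -- Two tangent steps of length one half give e ≥ (1 + 1/2)², which exceeds 2 by `half * half`.
  2<e : fromℕ 2 < e
  2<e = ≰⇒> λ e≤2 → <⇒≱ (0<* 0<half 0<half) (difference
      (0≤- e≤2 ⊕ 0≤≈ (reflexive (≡.sym (exp≡expSeries 0≤1)))
        ⊕ 0≤- (expSeries-tangent 0≤half half≤1)
        ⊕ (0≤1 ⊕ 0≤- half≤1) ⊗ 0≤- (1+x≤expSeries 0≤half)
        ⊕ 0≤* half (sym half+half))
      (solve 4 (λ e e′ f h →
        h :* h :+ (:2 :- e :+ (e :- e′) :+ (e′ :- (:1 :+ (:1 :- h)) :* f)
          :+ (:1 :+ (:1 :- h)) :* (f :- (:1 :+ h)) :+ h :* (:1 :- (h :+ h))) := :0)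
        refl e (expSeries 1#) (expSeries half) half))
    where
    0<half : 0# < half
    0<half = 0<*⁻¹ (pos-≤ 0<1 (difference 0≤1 refl))
    half≤1 : half ≤ 1#
    half≤1 = difference 0≤half half+half

  private
    exp≤2 : ℝ → Set
    exp≤2 y = exp y ≤ fromℕ 2

    ≤1 : IsUpperBound exp≤2 1#
    ≤1 y exp-y≤2 = ≤-stable λ y≰1 →
      let 0≤y = ≤-trans 0≤1 (≰⇒≥ y≰1) in
      y≰1 (difference (0≤- exp-y≤2 ⊕ 0≤≈ (reflexive (≡.sym (exp≡expSeries 0≤y))) ⊕ 0≤- (1+x≤expSeries 0≤y))
        (solve 3 (λ y a b → y :+ (:2 :- a :+ (a :- b) :+ (b :- (:1 :+ y))) := :1) refl
          y (exp y) (expSeries y)))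

    exp-0≤2 : exp≤2 0#
    exp-0≤2 = ≤-trans (≤-reflexive (reflexive (exp≡expSeries ≤-refl)))
      (≤-trans expSeries-0 (difference (0≤1 ⊕ ≤-refl) refl))

    isLub : IsLub exp≤2 (log (fromℕ 2))
    isLub = ⨆-isLub exp≤2 (0# , exp-0≤2) (1# , ≤1)

  log2≤1 : log (fromℕ 2) ≤ 1#
  log2≤1 = proj₂ isLub 1# ≤1

  -- (1 − t) exp t ≤ 1, iterated.
  ^*expSeries≤1 : ∀ {t} → 0# ≤ t → t ≤ 1# → ∀ k → (1# - t) ^ k * expSeries (fromℕ k * t) ≤ 1#
  ^*expSeries≤1 {t} 0≤t t≤1 zero = ≤-trans (≤-reflexive (*-identityˡ _))
    (≤-trans (≤-reflexive (expSeries-cong (≤-refl ⊗ 0≤t) (zeroˡ t))) expSeries-0)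
  ^*expSeries≤1 {t} 0≤t t≤1 (suc k) = difference
    (0≤^ k (0≤- t≤1) ⊗ 0≤- (expSeries-secant (0≤fromℕ k ⊗ 0≤t) kt≤) ⊕ 0≤- (^*expSeries≤1 0≤t t≤1 k))
    (solve 5 (λ t k a e f → (:1 :- t) :* a :* f :+ (a :* (e :+ ((:1 :+ k) :* t :- k :* t) :* f :- f)
        :+ (:1 :- a :* e)) := :1) refl
      t (fromℕ k) ((1# - t) ^ k) (expSeries (fromℕ k * t)) (expSeries (fromℕ (suc k) * t)))
    where
    kt≤ : fromℕ k * t ≤ fromℕ (suc k) * t
    kt≤ = difference 0≤t (solve 2 (λ k t → k :* t :+ t := (:1 :+ k) :* t) refl (fromℕ k) t)

  -- The power is at most exp(-k/R) by `^*expSeries≤1`, and base 2 only weakens this since log 2 ≤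
  -- 1.
  ^≤2** : ∀ {R} → 1# ≤ R → ∀ k → (1# - R ⁻¹) ^ k ≤ fromℕ 2 ** (- (fromℕ k / R))
  ^≤2** {R} 1≤R k = bound _ (solve 2 (λ a l → :- (a :* l) := :- a :* l) refl (fromℕ k / R) (log (fromℕ 2)))
    where
    0<R : 0# < R
    0<R = pos-≤ 0<1 1≤R
    t = R ⁻¹
    0≤t : 0# ≤ t
    0≤t = proj₁ (0<*⁻¹ 0<R)
    t≤1 : t ≤ 1#
    t≤1 = difference (0≤t ⊗ 0≤- 1≤R ⊕ 0≤* 1# (sym (*-⁻¹ 0<R)))
      (solve 2 (λ r t → t :+ (t :* (r :- :1) :+ :1 :* (:1 :- r :* t)) := :1) refl R t)
    0≤θ^k = 0≤^ k (0≤- t≤1)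
    0≤kt : 0# ≤ fromℕ k * t
    0≤kt = 0≤fromℕ k ⊗ 0≤t
    θ^k≤1 : (1# - t) ^ k ≤ 1#
    θ^k≤1 = difference (0≤^ k (0≤- t≤1) ⊗ 0≤- (1≤expSeries 0≤kt) ⊕ 0≤- (^*expSeries≤1 0≤t t≤1 k))
      (solve 2 (λ a e → a :+ (a :* (e :- :1) :+ (:1 :- a :* e)) := :1) refl ((1# - t) ^ k) (expSeries (fromℕ k * t)))
    -- The exponent is a variable so that the sign test in `exp` can be split on; a non-negative
    -- exponent is covered by the power being at most `1#`.
    bound : ∀ z → - (fromℕ k * t * log (fromℕ 2)) ≈ z → (1# - t) ^ k ≤ exp z
    bound z -≈z with 0# ≤? z
    ... | yes 0≤z = ≤-trans θ^k≤1 (1≤expSeries 0≤z)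
    ... | no  0≰z = *-cancelˡ-≤ 0<E (≤-trans
          (*-mono-≤ (proj₁ 0<E) (expSeries-mono 0≤-z -z≤kt) 0≤θ^k ≤-refl)
          (≤-trans (≤-reflexive (*-comm _ _)) (≤-trans (^*expSeries≤1 0≤t t≤1 k) (≤-reflexive (sym (*-⁻¹ 0<E))))))
      where
      0≤-z : 0# ≤ - z
      0≤-z = difference (0≤- (≰⇒≥ 0≰z)) (solve 1 (λ z → :0 :+ (:0 :- z) := :- z) refl z)
      0<E : 0# < expSeries (- z)
      0<E = pos-≤ 0<1 (1≤expSeries 0≤-z)
      -z≤kt : - z ≤ fromℕ k * t
      -z≤kt = difference (0≤kt ⊗ 0≤- log2≤1 ⊕ 0≤≈ -≈z)
        (solve 3 (λ z a l → :- z :+ (a :* (:1 :- l) :+ (z :- :- (a :* l))) := a) refl z (fromℕ k * t) (log (fromℕ 2)))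

-- The exponential Lyapunov function obtained from the drift.

module Drift (𝓡 : CompleteOrderedField) where
  open CompleteOrderedField 𝓡
  open Analysis 𝓡
  open Chains 𝓡
  open OrderedField 𝓡
  open UnorderedSums 𝓡
  open KilledChain 𝓡
  open RestrictedChain 𝓡
  open Exponential 𝓡

  module _ {m : ℝ} (0≤m : 0# ≤ m) (4m≤1 : fromℕ 4 * m ≤ 1#) where

    2m≤1 : (1# + 1#) * m ≤ 1#
    2m≤1 = difference (0≤2 ⊗ 0≤m ⊕ 0≤- 4m≤1)
      (solve 1 (λ m → (:1 :+ :1) :* m :+ ((:1 :+ :1) :* m :+ (:1 :- :4 :* m)) := :1) refl m)

    ≤m⇒square≤ : ∀ {t} → 0# ≤ t → t ≤ m → t * t ≤ m * m
    ≤m⇒square≤ 0≤t t≤m = *-mono-≤ 0≤t t≤m 0≤t t≤m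

    -- With t = y - x, multiply (1 - t) exp y ≤ exp x by 1 + t + 2t². The product (1 - t)(1 + t +
    -- 2t²) = 1 + t²(1 - 2t) is at least 1 because 2t ≤ 1.
    expSeries-up : ∀ {x y} → 0# ≤ x → x ≤ y → y - x ≤ m →
                   expSeries y ≤ expSeries x * (1# + (1# + 1#) * (m * m) + (y - x))
    expSeries-up {x} {y} 0≤x x≤y t≤m = difference
      ((0≤1 ⊕ 0≤t ⊕ 0≤2 ⊗ (0≤t ⊗ 0≤t)) ⊗ 0≤- (expSeries-secant 0≤x x≤y)
        ⊕ 0≤t ⊗ 0≤t ⊗ (0≤- 2m≤1 ⊕ 0≤2 ⊗ 0≤- t≤m) ⊗ ≤-trans 0≤1 (1≤expSeries (≤-trans 0≤x x≤y))
        ⊕ 0≤2 ⊗ ≤-trans 0≤1 (1≤expSeries 0≤x) ⊗ 0≤- (≤m⇒square≤ 0≤t t≤m))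
      (solve 4 (λ f e t m →
        f :+ ((:1 :+ t :+ (:1 :+ :1) :* (t :* t)) :* (e :+ t :* f :- f)
          :+ t :* t :* (:1 :- (:1 :+ :1) :* m :+ (:1 :+ :1) :* (m :- t)) :* f
          :+ (:1 :+ :1) :* e :* (m :* m :- t :* t))
        := e :* (:1 :+ (:1 :+ :1) :* (m :* m) :+ t)) refl (expSeries y) (expSeries x) (y - x) m)
      where 0≤t = 0≤- x≤y

    -- With t = y - x, multiply (1 + t) exp x ≤ exp y by 1 - t + t², using (1 + t)(1 - t + t²) = 1 +
    -- t³.
    expSeries-down : ∀ {x y} → 0# ≤ x → x ≤ y → y - x ≤ m →
                     expSeries x + expSeries y * (y - x) ≤ expSeries y * (1# + (1# + 1#) * (m * m))
    expSeries-down {x} {y} 0≤x x≤y t≤m = difference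
      ((0≤m ⊕ 0≤- 2m≤1 ⊕ 0≤- t≤m ⊕ 0≤t ⊗ 0≤t) ⊗ 0≤- (expSeries-tangent 0≤x x≤y)
        ⊕ 0≤t ⊗ 0≤t ⊗ 0≤t ⊗ ≤-trans 0≤1 (1≤expSeries 0≤x)
        ⊕ ≤-trans 0≤1 (1≤expSeries 0≤y) ⊗ (0≤m ⊗ 0≤m ⊕ 0≤- (≤m⇒square≤ 0≤t t≤m)))
      (solve 4 (λ f e t m →
        e :+ f :* t :+ ((m :+ (:1 :- (:1 :+ :1) :* m) :+ (m :- t) :+ t :* t) :* (f :- (:1 :+ t) :* e)
          :+ t :* t :* t :* e :+ f :* (m :* m :+ (m :* m :- t :* t)))
        := f :* (:1 :+ (:1 :+ :1) :* (m :* m))) refl (expSeries y) (expSeries x) (y - x) m)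
      where 0≤t = 0≤- x≤y
            0≤y = ≤-trans 0≤x x≤y

    expSeries≤2 : ∀ {y} → 0# ≤ y → y ≤ m → expSeries y ≤ 1# + 1#
    expSeries≤2 {y} 0≤y y≤m = difference
      (0≤2 ⊗ (0≤- expSeries-0 ⊕ 0≤- (expSeries-secant ≤-refl 0≤y))
        ⊕ (0≤- 2m≤1 ⊕ 0≤2 ⊗ 0≤- y≤m) ⊗ ≤-trans 0≤1 (1≤expSeries 0≤y))
      (solve 4 (λ f e t m → f :+ ((:1 :+ :1) :* (:1 :- e :+ (e :+ (t :- :0) :* f :- f))
          :+ (:1 :- (:1 :+ :1) :* m :+ (:1 :+ :1) :* (m :- t)) :* f) := :1 :+ :1) refl
        (expSeries y) (expSeries 0#) y m)

  module Drifting {A : Set} (_≟ᴬ_ : DecidableEquality A) {p : Kernel A} (stochastic : IsStochastic p)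
    (V : A → ℝ) (b : ℝ) {ν γ : ℝ} (0<ν : 0# < ν) (0<γ : 0# < γ)
    (jump : ∀ x y → 0# < p x y → ∣ V y - V x ∣ ≤ ν)
    (drift : ∀ x → b < V x → 𝔼 (p x) (λ y → V y - V x) < - γ) where
    open Restricted _≟ᴬ_ stochastic V b

    -- `μ` is `s * ν`, the largest change of the exponent along a possible transition. The drift
    -- earns `s * γ`, which is 4μ², against a quadratic error of 2μ²; the rest is `δ`.
    μ s δ : ℝ
    μ = γ / (fromℕ 4 * ν)
    s = μ / ν
    δ = (1# + 1#) * (μ * μ)

    private
      0<4ν : 0# < fromℕ 4 * ν
      0<4ν = 0<* (0<fromℕ-suc 3) 0<ν

    0<μ : 0# < μ
    0<μ = 0<* 0<γ (0<*⁻¹ 0<4ν)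

    0<s : 0# < s
    0<s = 0<* 0<μ (0<*⁻¹ 0<ν)

    0<δ : 0# < δ
    0<δ = 0<* (pos-≤ 0<1 (difference 0≤1 refl)) (0<* 0<μ 0<μ)

    4νμ≈γ : fromℕ 4 * ν * μ ≈ γ
    4νμ≈γ = *-/-cancel 0<4ν

    sν≈μ : s * ν ≈ μ
    sν≈μ = trans (*-comm s ν) (*-/-cancel 0<ν)

    ΔV≤ν : ∀ x y → 0# < p x y → V y - V x ≤ ν
    ΔV≤ν x y 0<pxy = ≤-trans (x≤x⊔y _ _) (jump x y 0<pxy)

    -ΔV≤ν : ∀ x y → 0# < p x y → - (V y - V x) ≤ ν
    -ΔV≤ν x y 0<pxy = ≤-trans (y≤x⊔y _ _) (jump x y 0<pxy)

    up down : A → A → ℝ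
    up   x y = (V y - V x) ⊔ 0#
    down x y = - (V y - V x) ⊔ 0#

    up≤ν : ∀ x y → 0# < p x y → up x y ≤ ν
    up≤ν x y 0<pxy = ⊔-case (_≤ ν) (V y - V x) 0# (ΔV≤ν x y 0<pxy) (proj₁ 0<ν)

    down≤ν : ∀ x y → 0# < p x y → down x y ≤ ν
    down≤ν x y 0<pxy = ⊔-case (_≤ ν) (- (V y - V x)) 0# (-ΔV≤ν x y 0<pxy) (proj₁ 0<ν)

    Sum-jump : ∀ x (d : A → ℝ) → (∀ y → 0# < p x y → d y ≤ ν) →
               Sum U (λ y → p x y * d y) (∑ U (λ y → p x y * d y)) × ∑ U (λ y → p x y * d y) ≤ ν
    Sum-jump x d d≤ν = Sum-∑ bounded , ∑-≤ bounded
      where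
      bounded : Bounded U (λ y → p x y * d y) ν
      bounded = Bounded-mono (λ y _ → *-monoˡ-≤-pos (nonNegative x y) (d≤ν y))
        (Bounded-mean (λ _ → ν) x (proj₁ 0<ν) (λ _ _ → ≤-refl))

    ∑up ∑down : A → ℝ
    ∑up   x = ∑ U (λ y → p x y * up x y)
    ∑down x = ∑ U (λ y → p x y * down x y)

    Sum-up : ∀ x → Sum U (λ y → p x y * up x y) (∑up x)
    Sum-up x = proj₁ (Sum-jump x (up x) (up≤ν x))

    Sum-down : ∀ x → Sum U (λ y → p x y * down x y) (∑down x)
    Sum-down x = proj₁ (Sum-jump x (down x) (down≤ν x))

    ∉B⇒drift : ∀ {x} → ¬ inB x → ∑up x - ∑down x ≤ - γ
    ∉B⇒drift {x} x∉B = proj₁ (drift x (≰⇒> x∉B))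

    -- A mean decrease of more than γ needs jumps at least that long, so γ ≤ ν and 4μ = γ/ν ≤ 1. The
    -- premise matters: if every state is in `B`, nothing relates γ to ν.
    ∉B⇒4μ≤1 : ∀ {x} → ¬ inB x → fromℕ 4 * μ ≤ 1#
    ∉B⇒4μ≤1 {x} x∉B = *-cancelˡ-≤ 0<ν (difference
      (0≤≈ 4νμ≈γ ⊕ 0≤- (∉B⇒drift x∉B) ⊕ 0≤Sum (Sum-up x)
        ⊕ 0≤- (proj₂ (Sum-jump x (down x) (down≤ν x))))
      (solve 5 (λ n m g u d → n :* (:4 :* m) :+ (g :- :4 :* n :* m :+ (:- g :- (u :- d)) :+ u :+ (n :- d)) := n :* :1)
        refl ν μ γ (∑up x) (∑down x)))

    height : A → ℝ
    height x = s * (V x - b)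

    w : A → ℝ
    w x with inB? x
    ... | yes _ = 0#
    ... | no  _ = expSeries (height x)

    0≤height : ∀ {x} → ¬ inB x → 0# ≤ height x
    0≤height x∉B = proj₁ 0<s ⊗ 0≤- (≰⇒≥ x∉B)

    w-∁B : ∀ {x} → ¬ inB x → w x ≡ expSeries (height x)
    w-∁B {x} x∉B with inB? x
    ... | yes x∈B = ⊥-elim (x∉B x∈B)
    ... | no  _   = ≡.refl

    w-B : ∀ {x} → inB x → w x ≡ 0#
    w-B {x} x∈B with inB? x
    ... | yes _   = ≡.refl
    ... | no  x∉B = ⊥-elim (x∉B x∈B)

    1≤w : ∀ {x} → ¬ inB x → 1# ≤ w x
    1≤w x∉B = ≤-trans (1≤expSeries (0≤height x∉B)) (≤-reflexive (reflexive (≡.sym (w-∁B x∉B))))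

    0≤w : ∀ x → 0# ≤ w x
    0≤w x with inB? x
    ... | yes _   = ≤-refl
    ... | no  x∉B = ≤-trans 0≤1 (1≤expSeries (0≤height x∉B))

    -- A state outside `B` that is one jump away from `B` has height at most `μ`, where the
    -- exponential is at most 2.
    mean-w-B : ∀ {x} → inB x → Bounded U (λ y → p x y * w y) (1# + 1#)
    mean-w-B {x} x∈B = Bounded-mono (λ y _ → *-monoˡ-≤-pos (nonNegative x y) (w≤2 y))
      (Bounded-mean (λ _ → 1# + 1#) x 0≤2 (λ _ _ → ≤-refl))
      where
      w≤2 : ∀ y → 0# < p x y → w y ≤ 1# + 1#
      w≤2 y 0<pxy with inB? y
      ... | yes _   = 0≤2
      ... | no  y∉B = expSeries≤2 (proj₁ 0<μ) (∉B⇒4μ≤1 y∉B) (0≤height y∉B) (difference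
        (proj₁ 0<s ⊗ (0≤- (ΔV≤ν x y 0<pxy) ⊕ 0≤- x∈B) ⊕ 0≤≈ sν≈μ)
        (solve 6 (λ s v u b n m → s :* (v :- b) :+ (s :* (n :- (v :- u) :+ (b :- u)) :+ (m :- s :* n)) := m) refl
          s (V y) (V x) b ν μ))

    mean-w-∁B : ∀ {x} → ¬ inB x → Bounded U (λ y → p x y * w y) ((1# - δ) * w x)
    mean-w-∁B {x} x∉B = Bounded-≤ (difference
        (0≤- total ⊕ 0≤E ⊗ proj₁ 0<s ⊗ 0≤- (∉B⇒drift x∉B) ⊕ 0≤* E sγ≈4μμ ⊕ 0≤≈ E*[1-δ])
        (solve 9 (λ W E s u d g m D w →
            W :+ (E :* (:1 :+ (:1 :+ :1) :* (m :* m)) :+ E :* s :* u :- (W :+ E :* s :* d)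
              :+ E :* s :* (:- g :- (u :- d)) :+ E :* (s :* g :- :4 :* (m :* m))
              :+ ((:1 :- D) :* w :- (:1 :- (:1 :+ :1) :* (m :* m)) :* E))
            := (:1 :- D) :* w) refl
          W E s (∑up x) (∑down x) γ μ δ (w x)))
      (upper Sum-w)
      where
      E = expSeries (height x)
      4μ≤1 = ∉B⇒4μ≤1 x∉B
      0≤E : 0# ≤ E
      0≤E = ≤-trans 0≤1 (1≤expSeries (0≤height x∉B))
      E*[1-δ] : (1# - δ) * E ≈ (1# - δ) * w x
      E*[1-δ] = *-congˡ (reflexive (≡.sym (w-∁B x∉B)))
      sγ≈4μμ : s * γ ≈ fromℕ 4 * (μ * μ)
      sγ≈4μμ = trans (*-congˡ (sym 4νμ≈γ))
        (trans (solve 3 (λ s n m → s :* (:4 :* n :* m) := :4 :* (s :* n :* m)) refl s ν μ)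
          (*-congˡ (*-congʳ sν≈μ)))
      0≤up : ∀ y → 0# ≤ up x y
      0≤up y = y≤x⊔y (V y - V x) 0#
      0≤down : ∀ y → 0# ≤ down x y
      0≤down y = y≤x⊔y (- (V y - V x)) 0#
      -- The downward part of the jump stays on the left, so that only non-negative families have to
      -- be summed.
      growth : ∀ y → 0# < p x y →
               w y + E * s * down x y ≤ E * (1# + (1# + 1#) * (μ * μ)) + E * s * up x y
      growth y 0<pxy with inB? y
      -- Entering `B` resets `w` to zero, and `s` times the drop is at most `μ`, hence below `1#`.
      ... | yes _ = difference
        (0≤E ⊗ (0≤- (2m≤1 (proj₁ 0<μ) 4μ≤1) ⊕ proj₁ 0<μ ⊕ 0≤2 ⊗ (proj₁ 0<μ ⊗ proj₁ 0<μ) ⊕ 0≤≈ sν≈μ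
            ⊕ proj₁ 0<s ⊗ (0≤up y ⊕ 0≤- (down≤ν x y 0<pxy))))
        (solve 6 (λ E s d u m n →
            :0 :+ E :* s :* d :+ E :* (:1 :- (:1 :+ :1) :* m :+ m :+ (:1 :+ :1) :* (m :* m) :+ (m :- s :* n)
                :+ s :* (u :+ (n :- d)))
            := E :* (:1 :+ (:1 :+ :1) :* (m :* m)) :+ E :* s :* u) refl E s (down x y) (up x y) μ ν)
      ... | no y∉B with ≤-total (V x) (V y)
      ...   | inj₁ x≤y = difference
        (0≤- (expSeries-up (proj₁ 0<μ) 4μ≤1 (0≤height x∉B)
            (*-monoˡ-≤ (proj₁ 0<s) (+-mono-≤ x≤y ≤-refl))
            (difference (proj₁ 0<s ⊗ 0≤- (ΔV≤ν x y 0<pxy) ⊕ 0≤≈ sν≈μ)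
              (solve 6 (λ s v u b n m → s :* (v :- b) :- s :* (u :- b) :+ (s :* (n :- (v :- u)) :+ (m :- s :* n)) := m)
                refl s (V y) (V x) b ν μ)))
          ⊕ 0≤E ⊗ proj₁ 0<s ⊗ (0≤- (x≤x⊔y (V y - V x) 0#) ⊕ 0≤- down≤0))
        (solve 9 (λ F E s d u m v x b →
            F :+ E :* s :* d :+ (E :* (:1 :+ (:1 :+ :1) :* (m :* m) :+ (s :* (v :- b) :- s :* (x :- b))) :- F
                :+ E :* s :* (u :- (v :- x) :+ (:0 :- d)))
            := E :* (:1 :+ (:1 :+ :1) :* (m :* m)) :+ E :* s :* u) refl
          (expSeries (height y)) E s (down x y) (up x y) μ (V y) (V x) b)
        where
        down≤0 : down x y ≤ 0#
        down≤0 = ⊔-case (_≤ 0#) (- (V y - V x)) 0#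
          (difference (0≤- x≤y) (solve 2 (λ v x → :- (v :- x) :+ (v :- x) := :0) refl (V y) (V x))) ≤-refl
      ...   | inj₂ y≤x = difference
        (0≤- (expSeries-down (proj₁ 0<μ) 4μ≤1 (0≤height y∉B)
            (*-monoˡ-≤ (proj₁ 0<s) (+-mono-≤ y≤x ≤-refl))
            (difference (proj₁ 0<s ⊗ 0≤- (-ΔV≤ν x y 0<pxy) ⊕ 0≤≈ sν≈μ)
              (solve 6 (λ s v u b n m → s :* (u :- b) :- s :* (v :- b) :+ (s :* (n :- :- (v :- u)) :+ (m :- s :* n)) := m)
                refl s (V y) (V x) b ν μ)))
          ⊕ 0≤E ⊗ proj₁ 0<s ⊗ (0≤up y ⊕ 0≤- down≤))
        (solve 9 (λ F E s d u m v x b →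
            F :+ E :* s :* d :+ (E :* (:1 :+ (:1 :+ :1) :* (m :* m)) :- (F :+ E :* (s :* (x :- b) :- s :* (v :- b)))
                :+ E :* s :* (u :+ (:- (v :- x) :- d)))
            := E :* (:1 :+ (:1 :+ :1) :* (m :* m)) :+ E :* s :* u) refl
          (expSeries (height y)) E s (down x y) (up x y) μ (V y) (V x) b)
        where
        down≤ : down x y ≤ - (V y - V x)
        down≤ = ⊔-case (_≤ - (V y - V x)) (- (V y - V x)) 0# ≤-refl
          (difference (0≤- y≤x) (solve 2 (λ v x → :0 :+ (x :- v) := :- (v :- x)) refl (V y) (V x)))
      0≤Es : 0# ≤ E * s
      0≤Es = 0≤E ⊗ proj₁ 0<s
      0≤q : 0# ≤ E * (1# + (1# + 1#) * (μ * μ))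
      0≤q = 0≤E ⊗ (0≤1 ⊕ proj₁ 0<δ)
      dominant : Bounded U (λ y → p x y * (E * (1# + (1# + 1#) * (μ * μ)) + E * s * up x y))
                           (E * (1# + (1# + 1#) * (μ * μ)) + E * s * ∑up x)
      dominant = Bounded-mono
        (λ y _ → ≤-reflexive (solve 4 (λ p q e u → p :* (q :+ e :* u) := p :* q :+ e :* (p :* u)) refl
          (p x y) (E * (1# + (1# + 1#) * (μ * μ))) (E * s) (up x y)))
        (Bounded-+ (Bounded-mean (λ _ → E * (1# + (1# + 1#) * (μ * μ))) x 0≤q (λ _ _ → ≤-refl))
                   (Bounded-* 0≤Es (upper (Sum-up x))))
      W = ∑ U (λ y → p x y * w y)
      Sum-w : Sum U (λ y → p x y * w y) W
      Sum-w = Sum-∑ (Bounded-mono (λ y _ → *-monoˡ-≤-pos (nonNegative x y) λ 0<pxy →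
          ≤-trans (difference (0≤Es ⊗ 0≤down y) refl) (growth y 0<pxy))
        dominant)
      total : W + E * s * ∑down x ≤ E * (1# + (1# + 1#) * (μ * μ)) + E * s * ∑up x
      total = Sum-≤ (Sum-+ _≟ᴬ_ (λ y _ → nonNegative x y ⊗ 0≤w y)
          (λ y _ → 0≤Es ⊗ (nonNegative x y ⊗ 0≤down y)) Sum-w (Sum-* 0≤Es (Sum-down x)))
        (λ y _ → ≤-trans
          (≤-reflexive (solve 4 (λ p w e d → p :* w :+ e :* (p :* d) := p :* (w :+ e :* d)) refl
            (p x y) (w y) (E * s) (down x y)))
          (*-monoˡ-≤-pos (nonNegative x y) (growth y)))
        dominant

    -- `Supersolution` demands a loss of `δ` from every state. On `B`, where `w` vanishes, the value
    -- is raised to the mean 2 after a step plus `δ`; killed means never see this value.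
    F : A → ℝ
    F = extend (λ _ → 1# + 1# + δ) w

    0≤F : ∀ x → 0# ≤ F x
    0≤F = extend-elim (0# ≤_) (λ _ → 0≤2 ⊕ proj₁ 0<δ) 0≤w

    mean-F : ∀ x → Bounded (∁ inB) (λ y → p x y * F y) (F x - δ)
    mean-F x = Bounded-mono
      (λ y y∉B → ≤-reflexive (*-congˡ (reflexive (extend-∁B _ w y y∉B)))) (Bounded-⊆ _ (mean-w (inB? x)))
      where
      mean-w : Dec (inB x) → Bounded U (λ y → p x y * w y) (F x - δ)
      mean-w (yes x∈B) = Bounded-≤
        (≤-reflexive (trans (solve 2 (λ a d → a := a :+ d :- d) refl (1# + 1#) δ)
          (+-congʳ (reflexive (≡.sym (extend-B _ w (x , [ x∈B ])))))))
        (mean-w-B x∈B)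
      mean-w (no x∉B) = Bounded-≤
        (≤-trans (difference (proj₁ 0<δ ⊗ 0≤- (1≤w x∉B))
            (solve 2 (λ d w → (:1 :- d) :* w :+ d :* (w :- :1) := w :- d) refl δ (w x)))
          (≤-reflexive (+-congʳ (reflexive (≡.sym (extend-∁B _ w x x∉B))))))
        (mean-w-∁B x∉B)

    open Supersolution F 0≤F 0<δ mean-F public using (Sum-hits)

-- Comparison of R with the stated order.

module RateBound (𝓡 : CompleteOrderedField) where
  open CompleteOrderedField 𝓡
  open Analysis 𝓡
  open Chains 𝓡
  open OrderedField 𝓡
  open UnorderedSums 𝓡
  open Exponential 𝓡

  κ : ℝ
  κ = e - fromℕ 2

  0<κ : 0# < κ
  0<κ = 0<- 2<e

  -- Two tangent steps of length u/2 give the factor (1 + u/2)², which is at least u²/4.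
  square*expSeries≤ : ∀ {x u} → 0# ≤ x → 0# ≤ u → u * u * expSeries x ≤ fromℕ 4 * expSeries (x + u)
  square*expSeries≤ {x} {u} 0≤x 0≤u = difference
    (0≤fromℕ 4 ⊗ (0≤- (expSeries-tangent (0≤x ⊕ 0≤a) x+a≤x+u)
        ⊕ (0≤1 ⊕ 0≤- x+a≤x+u) ⊗ 0≤- (expSeries-tangent 0≤x x≤x+a))
      ⊕ 0≤fromℕ 4 ⊗ (0≤1 ⊕ 0≤u) ⊗ 0≤E
      ⊕ 0≤* (E * (u - (a + a))) (sym u≈2a))
    (solve 6 (λ x u a e f g →
        u :* u :* e :+ (:4 :* (g :- (:1 :+ (x :+ u :- (x :+ a))) :* f
            :+ (:1 :+ (x :+ u :- (x :+ a))) :* (f :- (:1 :+ (x :+ a :- x)) :* e))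
          :+ :4 :* (:1 :+ u) :* e :+ e :* (u :- (a :+ a)) :* (a :+ a :- u))
        := :4 :* g) refl x u a E (expSeries (x + a)) (expSeries (x + u)))
    where
    a = u * half
    E = expSeries x
    0≤a : 0# ≤ a
    0≤a = 0≤u ⊗ 0≤half
    0≤E = ≤-trans 0≤1 (1≤expSeries 0≤x)
    u≈2a : u ≈ a + a
    u≈2a = trans (sym (*-identityʳ u)) (trans (*-congˡ (sym half+half)) (distribˡ u half half))
    x≤x+a : x ≤ x + a
    x≤x+a = difference 0≤a refl
    x+a≤x+u : x + a ≤ x + u
    x+a≤x+u = difference (0≤a ⊕ 0≤≈ (sym u≈2a)) (solve 3 (λ x a u → x :+ a :+ (a :+ (u :- (a :+ a))) := x :+ u) refl x a u)

  -- With E for `expSeries u`, the summands bound four times the products κu²·E, κu²·κu², 8κ⁻¹·E and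
  -- 8κ⁻¹·κu² from the left side of `rate-poly`, in this order. Only e is involved, so one constant
  -- serves all chains.
  constant : ℝ
  constant = fromℕ 4 * fromℕ 4 * κ + fromℕ 4 * fromℕ 4 * fromℕ 4 * (κ * κ)
    + (1# + 1#) * (fromℕ 4 * fromℕ 4 * κ ⁻¹) + (1# + 1#) * (fromℕ 4 * fromℕ 4 * fromℕ 4)

  -- The comparison of `radius` with `rate`, denominators cleared and written in u = ην: 1 - ρ is
  -- κu² and (1 - ρ)/μ² is 4/κ. In place of the addition formula, `square*expSeries≤` absorbs each
  -- factor u² at the price of a factor 4.
  rate-poly : ∀ {u} → 0# ≤ u →
    fromℕ 4 * (κ * (u * u) + (1# + 1#) * (fromℕ 4 * κ ⁻¹)) * (expSeries u - 1# + κ * (u * u))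
      ≤ constant * expSeries (u + u)
  rate-poly {u} 0≤u = difference
    (0≤q ⊗ 0≤κ ⊗ 0≤- u²E≤qG
      ⊕ 0≤2 ⊗ (0≤q ⊗ 0≤q ⊗ 0≤κ⁻¹) ⊗ 0≤- E≤G
      ⊕ 0≤q ⊗ (0≤κ ⊗ 0≤u² ⊕ 0≤2 ⊗ (0≤q ⊗ 0≤κ⁻¹))
      ⊕ 0≤q ⊗ (0≤κ ⊗ 0≤κ) ⊗ (0≤q ⊗ 0≤- u²E≤qG ⊕ 0≤u² ⊗ 0≤- u²≤qE)
      ⊕ 0≤2 ⊗ (0≤q ⊗ 0≤q) ⊗ (0≤q ⊗ 0≤- E≤G ⊕ 0≤- u²≤qE)
      ⊕ 0≤* ((1# + 1#) * (q * q) * (u * u)) (sym (*-⁻¹ 0<κ)))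
    (solve 6 (λ q k i v E G →
        q :* (k :* v :+ (:1 :+ :1) :* (q :* i)) :* (E :- :1 :+ k :* v)
          :+ (q :* k :* (q :* G :- v :* E)
            :+ (:1 :+ :1) :* (q :* q :* i) :* (G :- E)
            :+ q :* (k :* v :+ (:1 :+ :1) :* (q :* i))
            :+ q :* (k :* k) :* (q :* (q :* G :- v :* E) :+ v :* (q :* E :- v))
            :+ (:1 :+ :1) :* (q :* q) :* (q :* (G :- E) :+ (q :* E :- v))
            :+ (:1 :+ :1) :* (q :* q) :* v :* (:1 :- k :* i))
        := (q :* q :* k :+ q :* q :* q :* (k :* k) :+ (:1 :+ :1) :* (q :* q :* i) :+ (:1 :+ :1) :* (q :* q :* q)) :* G)
      refl q κ (κ ⁻¹) (u * u) E G)
    where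
    q = fromℕ 4
    E = expSeries u
    G = expSeries (u + u)
    0≤q = 0≤fromℕ 4
    0≤κ = proj₁ 0<κ
    0≤κ⁻¹ = proj₁ (0<*⁻¹ 0<κ)
    0≤u² : 0# ≤ u * u
    0≤u² = 0≤u ⊗ 0≤u
    E≤G : E ≤ G
    E≤G = expSeries-mono 0≤u (difference 0≤u refl)
    u²E≤qG : u * u * E ≤ q * G
    u²E≤qG = square*expSeries≤ 0≤u 0≤u
    u²≤qE : u * u ≤ q * E
    u²≤qE = ≤-trans (difference (0≤u² ⊗ 0≤- (1≤expSeries ≤-refl))
        (solve 2 (λ v e → v :+ v :* (e :- :1) := v :* e) refl (u * u) (expSeries 0#)))
      (≤-trans (square*expSeries≤ ≤-refl 0≤u) (*-monoˡ-≤ 0≤q (≤-reflexive (expSeries-cong (≤-refl ⊕ 0≤u) (+-identityˡ u)))))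

  module _ {ν γ : ℝ} (0<ν : 0# < ν) (0<γ : 0# < γ) where
    open Scalars γ ν

    μ² : ℝ
    μ² = γ / (fromℕ 4 * ν) * (γ / (fromℕ 4 * ν))

    private
      q μ u r : ℝ
      q = fromℕ 4
      μ = γ / (q * ν)
      u = η * ν
      r = 1# - ρ

      0<2 : 0# < fromℕ 2
      0<2 = 0<fromℕ-suc 1
      0<q : 0# < q
      0<q = 0<fromℕ-suc 3
      0<ν² : 0# < ν ^ 2
      0<ν² = 0<^ 2 0<ν
      0<η : 0# < η
      0<η = 0<* 0<γ (0<*⁻¹ (0<* (0<* 0<2 0<κ) 0<ν²))
      0<u : 0# < u
      0<u = 0<* 0<η 0<ν
      0<μ : 0# < μ
      0<μ = 0<* 0<γ (0<*⁻¹ (0<* 0<q 0<ν))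

      κu≈2μ : κ * u ≈ fromℕ 2 * μ
      κu≈2μ = *-cancelˡ-≈ (0<* 0<2 0<ν) (trans
        (solve 3 (λ n k h → :2 :* n :* (k :* (h :* n)) := :2 :* k :* (n :* (n :* :1)) :* h) refl ν κ η)
        (trans (*-/-cancel (0<* (0<* 0<2 0<κ) 0<ν²))
        (trans (sym (*-/-cancel (0<* 0<q 0<ν)))
          (solve 2 (λ n m → :4 :* n :* m := :2 :* n :* (:2 :* m)) refl ν μ))))

      r-≈ : r ≈ γ ^ 2 / (q * κ * ν ^ 2)
      r-≈ = solve 1 (λ a → :1 :- (:1 :- a) := a) refl (γ ^ 2 / (q * κ * ν ^ 2))

      κr≈4μ² : κ * r ≈ q * μ²
      κr≈4μ² = *-cancelˡ-≈ (0<* 0<q 0<ν²) (trans (*-congˡ (*-congˡ r-≈)) (trans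
        (solve 3 (λ n k s → :4 :* n :* (k :* s) := :4 :* k :* n :* s) refl (ν ^ 2) κ _)
        (trans (*-/-cancel (0<* (0<* 0<q 0<κ) 0<ν²))
        (trans (*-cong (sym (*-/-cancel (0<* 0<q 0<ν))) (*-congʳ (sym (*-/-cancel (0<* 0<q 0<ν)))))
          (solve 2 (λ n m → :4 :* n :* m :* (:4 :* n :* m :* :1) := :4 :* (n :* (n :* :1)) :* (:4 :* (m :* m)))
            refl ν μ)))))

      r≈κu² : r ≈ κ * (u * u)
      r≈κu² = *-cancelˡ-≈ 0<κ (trans κr≈4μ² (trans
        (solve 1 (λ m → :4 :* (m :* m) := :2 :* m :* (:2 :* m)) refl μ)
        (trans (*-cong (sym κu≈2μ) (sym κu≈2μ))
          (solve 2 (λ k u → k :* u :* (k :* u) := k :* (k :* (u :* u))) refl κ u))))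

    0<μ² : 0# < μ²
    0<μ² = 0<* 0<μ 0<μ

    private
      μ⁻²r≈4κ⁻¹ : μ² ⁻¹ * r ≈ q * κ ⁻¹
      μ⁻²r≈4κ⁻¹ = *-cancelˡ-≈ 0<κ (trans
        (solve 3 (λ k i r → k :* (i :* r) := i :* (k :* r)) refl κ (μ² ⁻¹) r)
        (trans (*-congˡ κr≈4μ²)
        (trans (solve 3 (λ i m q → i :* (q :* m) := q :* (m :* i)) refl (μ² ⁻¹) μ² q)
        (trans (*-congˡ (trans (*-⁻¹ 0<μ²) (sym (*-⁻¹ 0<κ))))
          (solve 3 (λ q k i → q :* (k :* i) := k :* (q :* i)) refl q κ (κ ⁻¹))))))

    -- As δ is 2μ², the last factor is 1 + 4/δ.
    radius : ℝ → ℝ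
    radius h = fromℕ 4 * h * (1# + (1# + 1#) * μ² ⁻¹)

    radius≤rate : ∀ {h} → 0# ≤ h → radius h ≤ constant * rate h
    radius≤rate {h} 0≤h = *-cancelˡ-≤ 0<D (≤-trans (≤-reflexive left)
      (≤-trans (*-monoˡ-≤ 0≤h (rate-poly (proj₁ 0<u))) (≤-reflexive right)))
      where
      E = exp (η * ν)
      G = exp (two * η * ν)
      D = (1# - ρ) * (E - ρ)
      E≈ : E ≈ expSeries u
      E≈ = reflexive (exp≡expSeries (proj₁ 0<u))
      2u≈ : two * η * ν ≈ u + u
      2u≈ = solve 2 (λ h n → :2 :* h :* n := h :* n :+ h :* n) refl η ν
      0≤2u : 0# ≤ two * η * ν
      0≤2u = proj₁ (0<* (0<* 0<2 0<η) 0<ν)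
      G≈ : G ≈ expSeries (u + u)
      G≈ = trans (reflexive (exp≡expSeries 0≤2u)) (expSeries-cong 0≤2u 2u≈)
      0<r : 0# < r
      0<r = pos-≤ (0<* 0<κ (0<* 0<u 0<u)) (≤-reflexive (sym r≈κu²))
      E-ρ≈ : E - ρ ≈ expSeries u - 1# + κ * (u * u)
      E-ρ≈ = trans (solve 2 (λ e r → e :- r := e :- :1 :+ (:1 :- r)) refl E ρ) (+-cong (+-congʳ E≈) r≈κu²)
      0<E-ρ : 0# < E - ρ
      0<E-ρ = pos-≤ 0<r (difference (0≤- (1≤expSeries (proj₁ 0<u)) ⊕ 0≤≈ (sym E≈))
        (solve 3 (λ p e f → :1 :- p :+ (f :- :1 :+ (e :- f)) := e :- p) refl ρ E (expSeries u)))
      0<D : 0# < D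
      0<D = 0<* 0<r 0<E-ρ
      left : D * radius h ≈ h * (q * (κ * (u * u) + (1# + 1#) * (q * κ ⁻¹)) * (expSeries u - 1# + κ * (u * u)))
      left = trans (solve 5 (λ r t q h i → r :* t :* (q :* h :* (:1 :+ (:1 :+ :1) :* i))
          := h :* (q :* (r :+ (:1 :+ :1) :* (i :* r)) :* t)) refl r (E - ρ) q h (μ² ⁻¹))
        (*-congˡ (*-cong (*-congˡ (+-cong r≈κu² (*-congˡ μ⁻²r≈4κ⁻¹))) E-ρ≈))
      right : h * (constant * expSeries (u + u)) ≈ D * (constant * rate h)
      right = trans (*-congˡ (*-congˡ (sym G≈))) (trans
        (solve 3 (λ h c g → h :* (c :* g) := c :* (h :* g)) refl h constant G)
        (trans (*-congˡ (sym (*-/-cancel 0<D)))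
          (solve 3 (λ d c r → c :* (d :* r) := d :* (c :* r)) refl D constant (rate h))))

-- The contracting function and the tail bound.

module TailBound (𝓡 : CompleteOrderedField) where
  open CompleteOrderedField 𝓡
  open Analysis 𝓡
  open Chains 𝓡
  open OrderedField 𝓡
  open UnorderedSums 𝓡
  open KilledChain 𝓡
  open RestrictedChain 𝓡
  open IrreducibleChain 𝓡
  open Drift 𝓡
  open Exponential 𝓡
  open RateBound 𝓡

  module ReturnTo {A : Set} (_≟ᴬ_ : DecidableEquality A) {p : Kernel A} (stochastic : IsStochastic p)
    (irreducible : IsIrreducible p) (V : A → ℝ) {ν γ : ℝ} (b : ℝ) (0<ν : 0# < ν) (0<γ : 0# < γ)
    (finite : Restriction.Finite-B p V b)
    (jump : ∀ x y → 0# < p x y → ∣ V y - V x ∣ ≤ ν)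
    (drift : ∀ x → b < V x → 𝔼 (p x) (λ y → V y - V x) < - γ)
    (i : Restriction.B p V b) where

    open Drifting _≟ᴬ_ stochastic V b 0<ν 0<γ jump drift
    open Irreducible _≟ᴬ_ stochastic irreducible V b finite
    open ReturnTime Sum-hits i
    private
      module Xⁱ = Killed {S = _≡ value i} (_≟ᴬ value i)

    -- Fixed before a supersolution is assumed: that one exists only up to double negation, from
    -- which inequalities about `R` can be extracted but no witness.
    R : ℝ
    R = radius 0<ν 0<γ (H i)

    h : B → ℝ
    h = Yⁱ.meanTime

    𝔼[Return]-terms : ∀ j n → fromℕ (suc n) * Yⁱ.hit (_≡ i) n j ≈ fromℕ (suc n) * ℙ[Return≡1+ n ] pʸ j i
    𝔼[Return]-terms j n = *-congˡ (sym (Sum⇒∑ (Yⁱ.Sum-hittingPaths (_≡ i) n j)))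

    module WithSupersolution (F′ : B → ℝ) (c : ℝ) (0≤F′ : ∀ y → 0# ≤ F′ y) (F′≤c : ∀ y → F′ y ≤ c)
      (mean-F′ : ∀ j → Bounded (_≢ i) (λ y → pʸ j y * F′ y) (F′ j - 1#)) where
      open Yⁱ.MeanTime F′ 0≤F′ mean-F′ renaming (Sum-hits to Sum-hitsʸ)

      Sum-𝔼[Return] : ∀ j → Sum U (λ n → fromℕ (suc n) * ℙ[Return≡1+ n ] pʸ j i) (h j)
      Sum-𝔼[Return] j = Sum-cong (λ n _ → 𝔼[Return]-terms j n) refl (Sum-meanTime j)

      Sum-return : ∀ j → Sum U (λ n → ℙ[Return≡1+ n ] pʸ j i) 1#
      Sum-return j = Sum-cong (λ n _ → sym (Sum⇒∑ (Yⁱ.Sum-hittingPaths (_≡ i) n j))) refl (Sum-hitsʸ j)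

      𝔼[Return]≈h : ∀ j → 𝔼[Return] pʸ j i ≈ h j
      𝔼[Return]≈h j = Sum⇒∑ (Sum-𝔼[Return] j)

      finiteMeanReturn : ∀ j → Sum U (λ n → ℙ[Return≡1+ n ] pʸ j i) 1# ×
        Sum U (λ n → fromℕ (suc n) * ℙ[Return≡1+ n ] pʸ j i) (𝔼[Return] pʸ j i)
      finiteMeanReturn j = Sum-return j , Sum-cong (λ _ _ → refl) (sym (𝔼[Return]≈h j)) (Sum-𝔼[Return] j)

      -- The supremum `H i` is constrained only for a bounded set; the bound `c` of the
      -- supersolution provides this.
      h≤H : ∀ j → h j ≤ H i
      h≤H j = ≤-trans (≤-reflexive (sym (𝔼[Return]≈h j)))
        (proj₁ (⨆-isLub _ (_ , j , refl)
          (c , λ { r (k , r≈) → ≤-trans (≤-reflexive (trans r≈ (𝔼[Return]≈h k))) (≤-trans (meanTime≤F k) (F′≤c k)) }))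
          (𝔼[Return] pʸ j i) (j , refl))

      1≤h : ∀ j → 1# ≤ h j
      1≤h j = difference (0≤Sum (Sum-meanTime-step j)) (solve 1 (λ h → :1 :+ (h :- :1) := h) refl (h j))

      1≤H : 1# ≤ H i
      1≤H = ≤-trans (1≤h i) (h≤H i)

      0≤H : 0# ≤ H i
      0≤H = ≤-trans 0≤1 1≤H

      g : A → ℝ
      g = entryMean (avoid h)

      0≤avoid-h : ∀ y → 0# ≤ avoid h y
      0≤avoid-h y = 0≤when (¬? (y ≟ᴮ i)) (0≤meanTime y)

      avoid-h≤H : ∀ y → avoid h y ≤ H i
      avoid-h≤H y = ≤-trans (avoid≤ h 0≤meanTime y) (h≤H y)

      h̃ : A → ℝ
      h̃ = extend h g

      0≤h̃ : ∀ x → 0# ≤ h̃ x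
      0≤h̃ = extend-elim (0# ≤_) 0≤meanTime (0≤entryMean (avoid h) 0≤H 0≤avoid-h avoid-h≤H)

      h̃≤H : ∀ x → h̃ x ≤ H i
      h̃≤H = extend-elim (_≤ H i) h≤H (entryMean≤ (avoid h) 0≤H 0≤avoid-h avoid-h≤H)

      -- Away from the target `h̃` agrees with the extension of `avoid h`, whose mean `firstStep`
      -- evaluates.
      mean-h̃ : ∀ x → Bounded (_≢ value i) (λ z → p x z * h̃ z) (g x)
      mean-h̃ x = Bounded-mono (λ z z≢i → *-monoˡ-≤ (nonNegative x z) (h̃≤ z z≢i))
        (Bounded-⊆ _ (upper (firstStep (avoid h) 0≤H 0≤avoid-h avoid-h≤H x)))
        where
        h̃≤ : ∀ z → z ≢ value i → h̃ z ≤ extend (avoid h) g z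
        h̃≤ z z≢i = split (inB? z)
          where
          split : Dec (inB z) → h̃ z ≤ extend (avoid h) g z
          split (no  z∉B) = ≤-reflexive (reflexive (≡.trans (extend-∁B h g z z∉B)
            (≡.sym (extend-∁B (avoid h) g z z∉B))))
          split (yes z∈B) = ≤-trans (≤-reflexive (reflexive (extend-B h g y)))
            (≤-trans (≤-reflexive (sym (when-yes (¬? (y ≟ᴮ i)) (h y) λ y≡i → z≢i (≡.cong value y≡i))))
              (≤-reflexive (reflexive (≡.sym (extend-B (avoid h) g y)))))
            where
            y : B
            y = z , [ z∈B ]

      g-B : ∀ j → g (value j) ≈ h j - 1#
      g-B j = entryMean-avoid h j (Sum-meanTime-step j)

      a t : ℝ
      a = (fromℕ 4 * H i) ⁻¹
      t = R ⁻¹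

      0<4H : 0# < fromℕ 4 * H i
      0<4H = 0<* (0<fromℕ-suc 3) (pos-≤ 0<1 1≤H)

      0<a : 0# < a
      0<a = 0<*⁻¹ 0<4H

      4Ha≈1 : fromℕ 4 * H i * a ≈ 1#
      4Ha≈1 = *-⁻¹ 0<4H

      0<m : 0# < μ * μ
      0<m = 0<* 0<μ 0<μ

      m⁻¹ : ℝ
      m⁻¹ = (μ * μ) ⁻¹

      0≤m⁻¹ : 0# ≤ m⁻¹
      0≤m⁻¹ = proj₁ (0<*⁻¹ 0<m)

      1≤R : 1# ≤ R
      1≤R = difference
        (0≤fromℕ 4 ⊗ 0≤- 1≤H ⊗ (0≤1 ⊕ 0≤2 ⊗ 0≤m⁻¹) ⊕ (0≤fromℕ 3 ⊕ 0≤fromℕ 4 ⊗ (0≤2 ⊗ 0≤m⁻¹)))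
        (solve 2 (λ h i → :1 :+ (:4 :* (h :- :1) :* (:1 :+ (:1 :+ :1) :* i)
            :+ ((:1 :+ :2) :+ :4 :* ((:1 :+ :1) :* i))) := :4 :* h :* (:1 :+ (:1 :+ :1) :* i)) refl (H i) m⁻¹)

      0<R : 0# < R
      0<R = pos-≤ 0<1 1≤R

      0≤t : 0# ≤ t
      0≤t = proj₁ (0<*⁻¹ 0<R)

      aR≈ : a * R ≈ 1# + (1# + 1#) * m⁻¹
      aR≈ = trans (sym (*-assoc a _ _)) (trans (*-congʳ (trans (*-comm a _) 4Ha≈1)) (*-identityˡ _))

      tR≈1 : R * t ≈ 1#
      tR≈1 = *-⁻¹ 0<R

      t≤a : t ≤ a
      t≤a = difference (0≤t ⊗ (0≤2 ⊗ 0≤m⁻¹) ⊕ 0≤* t aR≈ ⊕ 0≤* a (sym tR≈1))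
        (solve 4 (λ t a r i → t :+ (t :* ((:1 :+ :1) :* i) :+ t :* (a :* r :- (:1 :+ (:1 :+ :1) :* i)) :+ a :* (:1 :- r :* t)) := a)
          refl t a R m⁻¹)

      -- Since a = t(1 + 4/δ), the right side is t(δ + 4).
      3t≤aδ : fromℕ 3 * t ≤ a * δ
      3t≤aδ = difference
        (0≤t ⊗ (proj₁ 0<δ ⊕ 0≤1) ⊕ 0≤* (a * δ) (sym tR≈1) ⊕ 0≤* (t * δ) aR≈
          ⊕ 0≤* (fromℕ 4 * t) (*-⁻¹ 0<m))
        (solve 5 (λ t a r i m → (:1 :+ :2) :* t
            :+ (t :* ((:1 :+ :1) :* m :+ :1) :+ a :* ((:1 :+ :1) :* m) :* (:1 :- r :* t)
              :+ t :* ((:1 :+ :1) :* m) :* (a :* r :- (:1 :+ (:1 :+ :1) :* i))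
              :+ :4 :* t :* (m :* i :- :1)) := a :* ((:1 :+ :1) :* m)) refl t a R m⁻¹ (μ * μ))

      f : A → ℝ
      f x = 1# + fromℕ 4 * a * h̃ x + a * w x

      1≤f : ∀ x → 1# ≤ f x
      1≤f x = difference (0≤fromℕ 4 ⊗ proj₁ 0<a ⊗ 0≤h̃ x ⊕ proj₁ 0<a ⊗ 0≤w x) (sym (+-assoc 1# _ _))

      f≤2+aw : ∀ x → f x ≤ 1# + 1# + a * w x
      f≤2+aw x = difference (0≤fromℕ 4 ⊗ proj₁ 0<a ⊗ 0≤- (h̃≤H x) ⊕ 0≤≈ 4Ha≈1)
        (solve 4 (λ a h H w → :1 :+ :4 :* a :* h :+ a :* w :+ (:4 :* a :* (H :- h) :+ (:1 :- :4 :* H :* a))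
          := :1 :+ :1 :+ a :* w) refl a (h̃ x) (H i) (w x))

      mean-f : ∀ x {v} → Bounded U (λ z → p x z * w z) v →
               Bounded (_≢ value i) (λ z → p x z * f z) (1# + fromℕ 4 * a * g x + a * v)
      mean-f x mean-w = Bounded-mono
        (λ z _ → ≤-reflexive (solve 4 (λ p a h w → p :* (:1 :+ :4 :* a :* h :+ a :* w)
          := p :+ :4 :* a :* (p :* h) :+ a :* (p :* w)) refl (p x z) a (h̃ z) (w z)))
        (Bounded-+ (Bounded-+ (Bounded-⊆ _ (upper (Sum-row x)))
          (Bounded-* (0≤fromℕ 4 ⊗ proj₁ 0<a) (mean-h̃ x))) (Bounded-* (proj₁ 0<a) (Bounded-⊆ _ mean-w)))

      contraction : ∀ x → Bounded (_≢ value i) (λ z → p x z * f z) ((1# - t) * f x)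
      contraction x = split (inB? x)
       where
       split : Dec (inB x) → Bounded (_≢ value i) (λ z → p x z * f z) ((1# - t) * f x)
       -- Here `g x` is `h̃ x - 1#`, which earns 4a, and the mean of `w` costs 2a. The remaining 2a
       -- is at least 2t, hence at least t · `f x`.
       split (yes x∈B) = Bounded-≤ (difference
          (0≤t ⊗ 0≤- (f≤2+aw x) ⊕ 0≤2 ⊗ 0≤- t≤a
            ⊕ 0≤* a w≈0 ⊕ 0≤* (t * a) (sym w≈0) ⊕ 0≤* (fromℕ 4 * a) (sym g≈))
          (solve 5 (λ t a h g w →
              :1 :+ :4 :* a :* g :+ a :* (:1 :+ :1) :+ (t :* (:1 :+ :1 :+ a :* w :- (:1 :+ :4 :* a :* h :+ a :* w))
                :+ (:1 :+ :1) :* (a :- t)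
                :+ a :* (w :- :0) :+ t :* a :* (:0 :- w) :+ :4 :* a :* (h :- :1 :- g))
              := (:1 :- t) :* (:1 :+ :4 :* a :* h :+ a :* w)) refl t a (h̃ x) (g x) (w x)))
          (mean-f x (mean-w-B x∈B))
        where
        w≈0 : w x ≈ 0#
        w≈0 = reflexive (w-B x∈B)
        g≈ : g x ≈ h̃ x - 1#
        g≈ = trans (g-B (x , [ x∈B ])) (+-congʳ (reflexive (≡.sym (extend-B h g (x , [ x∈B ])))))
       -- Here `g x` equals `h̃ x`, and only `w` pays: aδw ≥ 3tw, while t · `f x` ≤ 2t + taw ≤ 3tw
       -- because w ≥ 1 and a ≤ 1.
       split (no x∉B) = Bounded-≤ (difference
          (0≤t ⊗ 0≤- (f≤2+aw x) ⊕ 0≤2 ⊗ 0≤t ⊗ 0≤- (1≤w x∉B) ⊕ 0≤- 3t≤aδ ⊗ 0≤w x ⊕ 0≤t ⊗ 0≤- a≤1 ⊗ 0≤w x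
            ⊕ 0≤* (fromℕ 4 * a) (sym g≈))
          (solve 6 (λ t a h g w d →
              :1 :+ :4 :* a :* g :+ a :* ((:1 :- d) :* w)
                :+ (t :* (:1 :+ :1 :+ a :* w :- (:1 :+ :4 :* a :* h :+ a :* w))
                :+ (:1 :+ :1) :* t :* (w :- :1) :+ (a :* d :- (:1 :+ :2) :* t) :* w :+ t :* (:1 :- a) :* w
                :+ :4 :* a :* (h :- g))
              := (:1 :- t) :* (:1 :+ :4 :* a :* h :+ a :* w)) refl t a (h̃ x) (g x) (w x) δ))
          (mean-f x (mean-w-∁B x∉B))
        where
        g≈ : g x ≈ h̃ x
        g≈ = reflexive (≡.sym (extend-∁B h g x x∉B))
        a≤1 : a ≤ 1#
        a≤1 = difference (0≤fromℕ 4 ⊗ 0≤- 1≤H ⊗ proj₁ 0<a ⊕ 0≤fromℕ 3 ⊗ proj₁ 0<a ⊕ 0≤≈ 4Ha≈1)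
          (solve 2 (λ a H → a :+ (:4 :* (H :- :1) :* a :+ (:1 :+ :2) :* a :+ (:1 :- :4 :* H :* a)) := :1) refl a (H i))

      f-target≤2 : f (value i) ≤ fromℕ 2
      f-target≤2 = ≤-trans (f≤2+aw (value i)) (≤-reflexive
        (trans (+-congˡ (trans (*-congˡ (reflexive (w-B (value∈B i)))) (zeroʳ a))) (solve 0 (:1 :+ :1 :+ :0 := :2) refl)))

      0≤1-t : 0# ≤ 1# - t
      0≤1-t = 0≤- (difference (0≤t ⊗ 0≤- 1≤R ⊕ 0≤≈ tR≈1)
        (solve 2 (λ t r → t :+ (t :* (r :- :1) :+ (:1 :- r :* t)) := :1) refl t R))

      tail : ∀ k → ℙ[Return> k ] p (value i) (value i) ≤ fromℕ 4 * fromℕ 2 ** (- (fromℕ k / R))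
      tail k = ≤-trans (≤-reflexive (Sum⇒∑ (Xⁱ.Sum-survivingPaths k (value i))))
        (≤-trans (Xⁱ.survive-geometric f 0≤1-t 1≤f contraction k (value i))
        (≤-trans (*-mono-≤ 0≤θᵏ (^≤2** 1≤R k) (≤-trans 0≤1 (1≤f (value i))) f-target≤2)
          (difference (0≤fromℕ 2 ⊗ ≤-trans 0≤θᵏ (^≤2** 1≤R k))
            (solve 1 (λ z → z :* :2 :+ :2 :* z := :4 :* z) refl (fromℕ 2 ** (- (fromℕ k / R)))))))
        where
        0≤θᵏ : 0# ≤ (1# - t) ^ k
        0≤θᵏ = 0≤^ k 0≤1-t

    private
      by-supersolution : ∀ {x y} → (∀ F′ c 0≤F′ F′≤c mean-F′ → x ≤ y) → x ≤ y
      by-supersolution {x} {y} k = ≤-stable λ x≰y → supersolution λ { (F′ , c , 0≤F′ , F′≤c , mean-F′) →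
        x≰y (k F′ c 0≤F′ F′≤c mean-F′) }

      -- A `Sum` is a family of inequalities, hence stable under double negation as they are.
      Sum-stable : ∀ {f : ℕ → ℝ} {r} → (∀ F′ c 0≤F′ F′≤c mean-F′ → Sum U f r) → Sum U f r
      Sum-stable k = record
        { upper = λ xs xs! Uxs → by-supersolution λ F′ c 0≤F′ F′≤c m → upper (k F′ c 0≤F′ F′≤c m) xs xs! Uxs
        ; least = λ u bd → by-supersolution λ F′ c 0≤F′ F′≤c m → least (k F′ c 0≤F′ F′≤c m) u bd }

    finiteMeanReturn : ∀ j → FiniteMeanReturn pʸ j i
    finiteMeanReturn j =
      Sum⇒HasSum (Sum-stable λ F′ c 0≤F′ F′≤c m → proj₁ (WithSupersolution.finiteMeanReturn F′ c 0≤F′ F′≤c m j)) ,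
      Sum⇒HasSum (Sum-stable λ F′ c 0≤F′ F′≤c m → proj₂ (WithSupersolution.finiteMeanReturn F′ c 0≤F′ F′≤c m j))

    0<R : 0# < R
    0<R = pos-≤ 0<1 (by-supersolution WithSupersolution.1≤R)

    R≤rate : R ≤ constant * Scalars.rate γ ν (H i)
    R≤rate = radius≤rate 0<ν 0<γ (by-supersolution WithSupersolution.0≤H)

    tailBound : ∀ k → ℙ[Return> k ] p (value i) (value i) ≤ fromℕ 4 * fromℕ 2 ** (- (fromℕ k / R))
    tailBound k = by-supersolution λ F′ c 0≤F′ F′≤c m → WithSupersolution.tail F′ c 0≤F′ F′≤c m k

lemma9 : (𝓡 : CompleteOrderedField) →
    let open CompleteOrderedField 𝓡
        open Analysis 𝓡
        open Chains 𝓡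
    in
    ∃ λ (C : ℝ) →
    (Σ : Set) → Σ ↣ ℕ →
    (p : Kernel Σ) → IsStochastic p → IsIrreducible p →
    (V : Σ → ℝ) → (∀ x → 0# ≤ V x) →
    (νmax γ b : ℝ) → 0# < νmax → 0# < γ → 0# ≤ b →
    let open Restriction p V b
        open Scalars γ νmax
    in
    Finite-B →
    (∀ x y → 0# < p x y → ∣ V y - V x ∣ ≤ νmax) →
    (∀ x → b < V x → 𝔼 (p x) (λ y → V y - V x) < - γ) →
    (i : B) →
    (∀ j → FiniteMeanReturn pʸ j i) ×
    (∃ λ (R : ℝ) → 0# < R × R ≤ C * rate (H i) ×
      (∀ (k : ℕ) → .{{_ : NonZero k}} →
        ℙ[Return> k ] p (value i) (value i) ≤ four * two ** (- (fromℕ k / R))))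
lemma9 𝓡 = RateBound.constant 𝓡 ,
  λ Σ countable p stochastic irreducible V _ νmax γ b 0<ν 0<γ _ finite jump drift i →
    -- Equality of states is decided by pulling it back along the injection into ℕ.
    let open TailBound.ReturnTo 𝓡 (via-injection countable ℕ._≟_) stochastic irreducible V b 0<ν 0<γ
               finite jump drift i
    in finiteMeanReturn , R , 0<R , R≤rate , λ k → tailBound k
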